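{- For every positive integer $n$ there exists a randomized algorithm that, for every stack $\pi$ of $n$ unburnt pancakes, produces (using random bits) a sequence of flips transforming $\pi$ into $(1,2,\dots,n)$, such that the average number of flips, where the average is taken both over all $n!$ stacks and over the random bits, is at most \[ \frac{17}{12}n+9 . \]
   Context: A stack of $n$ (unburnt) pancakes is a permutation $\pi\in S_n$, $\pi(i)$ being the size of the $i$-th pancake from the top. An $i$-flip reverses the order of the top $i$ pancakes (a prefix reversal of $\pi$). The stack is sorted when it equals $(1,2,\dots,n)$, i.e. sizes increase from top to bottom. -}

module Defs where

open import Data.Nat using (ℕ; zero; suc; _≤_)
open import Data.Product using (_×_)
open import Data.List using (List; []; _∷_; reverse; take; drop; _++_; map; upTo)

-- The sorted stack (1,2,...,n), top pancake first.
sorted : ℕ → List ℕ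
sorted n = map suc (upTo n)

flip : ℕ → List ℕ → List ℕ
flip i π = reverse (take i π) ++ drop i π

applyFlips : List ℕ → List ℕ → List ℕ
applyFlips []       π = π
applyFlips (i ∷ is) π = applyFlips is (flip i π)

ValidFlip : ℕ → ℕ → Set
ValidFlip n i = (1 ≤ i) × (i ≤ n)

{-# OPTIONS --safe #-}
-- A stack is a signed arrangement of m blocks labelled by their cyclic order; the sign of a single pancake is a random bit.
-- Each round joins the top block to one of its two cyclic neighbours, using 1, 2 or 3 flips according to the signs and the
-- order of the neighbours, in such a way that a uniformly random signed arrangement of m blocks becomes a uniformly random
-- signed arrangement of m - 1 blocks: the rest of the stack is either untouched or turned over above the neighbour, which
-- is an involution. So the expected cost depends only on the cyclic word of types (single pancakes, blocks), and it is
-- bounded by a potential of that word, averaging over its rotations. Single pancakes start in pairs 2i+1, 2i+2: joining a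
-- pair costs 1 flip, adding a single pancake to a block 3/2 flips and joining two blocks 13/8 flips on average. A block that
-- breaks a pair overspends by 4/24 of a flip, and at most two blocks neighbour a pair, which saves 8/24.
module Submission where

open import Defs
open import Data.Nat using (ℕ; _≤_; _<_; _*_; _+_)
open import Data.Nat using (_!)
open import Data.Fin using (Fin)
open import Data.Product using (Σ; _×_)
open import Data.List using (List; length; map; allFin)
open import Data.Nat.ListAction using (sum)
open import Data.List.Relation.Unary.All using (All)
open import Data.List.Relation.Unary.Unique.Propositional using (Unique)
open import Data.List.Membership.Propositional using (_∈_)
open import Data.List.Relation.Binary.Permutation.Propositional using (_↭_)
open import Relation.Binary.PropositionalEquality using (_≡_)
open import Function.Bundles using (_⇔_)
open import Data.Bool using (Bool; true; false; not; if_then_else_; _∧_; T)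
open import Data.Bool.Properties as Bool using (not-involutive)
open import Data.List using ([]; _∷_; [_]; _++_; _∷ʳ_; initLast; _∷ʳ′_; concat; concatMap; upTo; applyUpTo; reverse; take; drop; zipWith; lookup)
open import Data.List.Membership.Propositional using (_∉_)
open import Data.List.Membership.Propositional.Properties using (∈-map⁺; ∈-map⁻; ∈-++⁺ˡ; ∈-++⁺ʳ; ∈-++⁻; ∈-upTo⁺; ∈-upTo⁻; ∈-concat⁺′; ∈-concat⁻′; ∈-lookup)
open import Data.List.Membership.Propositional.Properties.WithK using (unique∧set⇒bag)
open import Data.List.Properties using (map-++; map-∘; map-cong; map-id; map-cong-local; map-upTo; upTo-∷ʳ; length-++; length-map; length-upTo; ∷-injectiveˡ; ∷-injectiveʳ; reverse-++; reverse-map; reverse-involutive; ++-assoc; ++-identityʳ; length-reverse; concat-++; take++drop≡id; map-tabulate; tabulate-lookup; concat-map-[_]; ≡-dec)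
open import Data.List.Relation.Binary.BagAndSetEquality using (∼bag⇒↭)
open import Data.List.Relation.Binary.Disjoint.Propositional using (Disjoint)
open import Data.List.Relation.Binary.Permutation.Propositional using (↭-refl; ↭-reflexive; ↭-trans; ↭-sym; ↭⇒↭ₛ)
import Data.List.Relation.Binary.Permutation.Propositional.Properties as Perm
open import Data.List.Relation.Binary.Permutation.Setoid.Properties using (Unique-resp-↭)
open import Data.List.Relation.Binary.Pointwise as Pointwise using (Pointwise; []; _∷_)
open import Data.List.Relation.Unary.All as All using ([]; _∷_)
import Data.List.Relation.Unary.All.Properties as All
open import Data.List.Relation.Unary.AllPairs using (AllPairs; []; _∷_)
import Data.List.Relation.Unary.AllPairs.Properties as AllPairs
open import Data.List.Relation.Unary.Any using (here; there)
import Data.List.Relation.Unary.Unique.Propositional.Properties as Unique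
open import Data.Nat using (zero; suc; pred; z≤n; s≤s; _∸_; _^_; _≡ᵇ_; _≤ᵇ_)
open import Data.Nat.GeneralisedArithmetic using (iterate)
open import Data.Nat.ListAction.Properties using (sum-++; sum-↭)
open import Data.Nat.Properties
open import Data.Nat.Tactic.RingSolver using (solve-∀)
open import Data.Product using (∃; ∃₂; _,_; proj₁; proj₂; map₁; map₂)
open import Data.Product.Properties as Product using ()
open import Data.Sum using (inj₁; inj₂)
open import Function using (_∘_; id)
open import Function.Bundles using (mk⇔; Equivalence)
open import Relation.Binary.PropositionalEquality using (_≢_; refl; sym; trans; cong; cong₂; subst; setoid; module ≡-Reasoning)
open import Relation.Nullary using (yes; no; contradiction)
open import Data.List.Membership.DecPropositional (≡-dec (Product.≡-dec _≟_ Bool._≟_)) using (_∈?_)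

-- Origin of the constant: before anything is joined a pair is worth 36 + 36 - 4 = 68 units of 1/24,
-- so a pancake costs 34/24 = 17/12. The worths 36 and 39 are prices: a single that joins a block
-- leaves the word and pays 3/2 flips, a block that joins a block pays 13/8. A pair turns into a
-- block, which leaves 68 - 39 = 29 units for its one flip of 24. A block that takes one half of a
-- pair destroys the deduction of 4. A given top label may therefore lose; only the sum over all top
-- labels is balanced, since a pair is joined when either of its halves is on top.
--
-- The obstacle is uniformity. Joining a pair with a given half on top always yields the same sign,
-- because the signs of two single pancakes are immaterial, so only half of the signed arrangements
-- is reached. The other half on top yields the opposite sign, and the two top labels have to be
-- added before the induction hypothesis applies.

-- Finite sums over lists.

∑ : {A : Set} → List A → (A → ℕ) → ℕ
∑ xs f = sum (map f xs)

module _ {A : Set} where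

  ∑-cong-∈ : {f g : A → ℕ} (xs : List A) → (∀ {x} → x ∈ xs → f x ≡ g x) → ∑ xs f ≡ ∑ xs g
  ∑-cong-∈ []       eq = refl
  ∑-cong-∈ (x ∷ xs) eq = cong₂ _+_ (eq (here refl)) (∑-cong-∈ xs (eq ∘ there))

  ∑-cong : {f g : A → ℕ} (xs : List A) → (∀ x → f x ≡ g x) → ∑ xs f ≡ ∑ xs g
  ∑-cong xs eq = ∑-cong-∈ xs (λ {x} _ → eq x)

  ∑-mono-∈ : {f g : A → ℕ} (xs : List A) → (∀ {x} → x ∈ xs → f x ≤ g x) → ∑ xs f ≤ ∑ xs g
  ∑-mono-∈ []       le = z≤n
  ∑-mono-∈ (x ∷ xs) le = +-mono-≤ (le (here refl)) (∑-mono-∈ xs (le ∘ there))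

  ∑-+ : (xs : List A) (f g : A → ℕ) → ∑ xs (λ x → f x + g x) ≡ ∑ xs f + ∑ xs g
  ∑-+ []       f g = refl
  ∑-+ (x ∷ xs) f g = begin
    (f x + g x) + ∑ xs (λ y → f y + g y)  ≡⟨ cong (f x + g x +_) (∑-+ xs f g) ⟩
    (f x + g x) + (∑ xs f + ∑ xs g)       ≡⟨ +-assoc (f x) (g x) _ ⟩
    f x + (g x + (∑ xs f + ∑ xs g))       ≡⟨ cong (f x +_) (+-assoc (g x) _ _) ⟨
    f x + (g x + ∑ xs f + ∑ xs g)         ≡⟨ cong (λ s → f x + (s + ∑ xs g)) (+-comm (g x) _) ⟩
    f x + (∑ xs f + g x + ∑ xs g)         ≡⟨ cong (f x +_) (+-assoc (∑ xs f) _ _) ⟩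
    f x + (∑ xs f + (g x + ∑ xs g))       ≡⟨ +-assoc (f x) _ _ ⟨
    (f x + ∑ xs f) + (g x + ∑ xs g)       ∎
    where open ≡-Reasoning

  ∑-* : (c : ℕ) (xs : List A) (f : A → ℕ) → ∑ xs (λ x → c * f x) ≡ c * ∑ xs f
  ∑-* c []       f = sym (*-zeroʳ c)
  ∑-* c (x ∷ xs) f = trans (cong (c * f x +_) (∑-* c xs f)) (sym (*-distribˡ-+ c (f x) _))

  ∑-const : (c : ℕ) (xs : List A) → ∑ xs (λ _ → c) ≡ length xs * c
  ∑-const c []       = refl
  ∑-const c (x ∷ xs) = cong (c +_) (∑-const c xs)

  ∑-++ : (xs ys : List A) (f : A → ℕ) → ∑ (xs ++ ys) f ≡ ∑ xs f + ∑ ys f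
  ∑-++ xs ys f = trans (cong sum (map-++ f xs ys)) (sum-++ (map f xs) (map f ys))

  ∑-↭ : {xs ys : List A} (f : A → ℕ) → xs ↭ ys → ∑ xs f ≡ ∑ ys f
  ∑-↭ f p = sum-↭ (Perm.map⁺ f p)

  unique-⇔-↭ : {xs ys : List A} → Unique xs → Unique ys → (∀ {x} → x ∈ xs ⇔ x ∈ ys) → xs ↭ ys
  unique-⇔-↭ ux uy eq = ∼bag⇒↭ (unique∧set⇒bag ux uy eq)

  AllPairs-map-∈ : {R S : A → A → Set} (xs : List A) → (∀ {x y} → x ∈ xs → y ∈ xs → R x y → S x y) →
                   AllPairs R xs → AllPairs S xs
  AllPairs-map-∈ []       r []       = []
  AllPairs-map-∈ (x ∷ xs) r (p ∷ ps) =
    All.tabulate (λ i → r (here refl) (there i) (All.lookup p i)) ∷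
    AllPairs-map-∈ xs (λ i j → r (there i) (there j)) ps

∑-map : {A B : Set} (h : A → B) (xs : List A) (f : B → ℕ) → ∑ (map h xs) f ≡ ∑ xs (f ∘ h)
∑-map h xs f = cong sum (sym (map-∘ xs))

∑-concatMap : {A B : Set} (h : A → List B) (xs : List A) (f : B → ℕ) →
              ∑ (concatMap h xs) f ≡ ∑ xs (λ x → ∑ (h x) f)
∑-concatMap h []       f = refl
∑-concatMap h (x ∷ xs) f = trans (∑-++ (h x) (concatMap h xs) f) (cong (∑ (h x) f +_) (∑-concatMap h xs f))

-- The image of `xs` under `φ` is again free of repetitions and has the same members, so it is a
-- rearrangement of `xs`. The inverse laws are asked on `xs` only, because the moves below are
-- reversible on valid stacks.
∑-bijection : {A : Set} (xs : List A) → Unique xs → (φ ψ : A → A) →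
              (∀ {x} → x ∈ xs → φ x ∈ xs) → (∀ {x} → x ∈ xs → ψ x ∈ xs) →
              (∀ {x} → x ∈ xs → ψ (φ x) ≡ x) → (∀ {x} → x ∈ xs → φ (ψ x) ≡ x) →
              (f : A → ℕ) → ∑ xs (f ∘ φ) ≡ ∑ xs f
∑-bijection xs u φ ψ φ∈ ψ∈ ψφ φψ f = trans (sym (∑-map φ xs f)) (∑-↭ f (unique-⇔-↭ u′ u (mk⇔ to from)))
  where
  u′ : Unique (map φ xs)
  u′ = AllPairs.map⁺ (AllPairs-map-∈ xs (λ i j x≢y eq → x≢y (trans (sym (ψφ i)) (trans (cong ψ eq) (ψφ j)))) u)
  to : ∀ {x} → x ∈ map φ xs → x ∈ xs
  to i with _ , j , refl ← ∈-map⁻ φ i = φ∈ j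
  from : ∀ {x} → x ∈ xs → x ∈ map φ xs
  from i = subst (_∈ map φ xs) (φψ i) (∈-map⁺ φ (ψ∈ i))

-- Signed arrangements

-- A stack carries labels 0, …, m-1 (the cyclic order of the blocks) and signs (their orientations).
Stack : Set
Stack = List (ℕ × Bool)

Valid : ℕ → Stack → Set
Valid m x = map proj₁ x ↭ upTo m

relabel : (ℕ → ℕ) → Stack → Stack
relabel f = map (map₁ f)

-- Cyclic predecessor and successor on the labels `0` to `k`: the modulus is `suc k`. `dec` undoes
-- `inc` on all of `ℕ`, but `inc` undoes `dec` only up to `k`, hence the validity assumption in
-- `unshift-shift`.
dec inc : ℕ → ℕ → ℕ
dec k zero    = k
dec k (suc j) = j
inc k j = if j ≡ᵇ k then 0 else suc j

shift unshift : ℕ → Stack → Stack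
shift k   = relabel (dec k)
unshift k = relabel (inc k)

≡ᵇ-refl : ∀ n → (n ≡ᵇ n) ≡ true
≡ᵇ-refl zero    = refl
≡ᵇ-refl (suc n) = ≡ᵇ-refl n

≡ᵇ-≢ : ∀ {m n} → m ≢ n → (m ≡ᵇ n) ≡ false
≡ᵇ-≢ {zero}  {zero}  p = contradiction refl p
≡ᵇ-≢ {zero}  {suc n} p = refl
≡ᵇ-≢ {suc m} {zero}  p = refl
≡ᵇ-≢ {suc m} {suc n} p = ≡ᵇ-≢ (p ∘ cong suc)

dec-inc : ∀ k j → dec k (inc k j) ≡ j
dec-inc k j with j ≟ k
... | yes refl rewrite ≡ᵇ-refl j = refl
... | no j≢k rewrite ≡ᵇ-≢ j≢k = refl

inc-dec : ∀ {k j} → j ≤ k → inc k (dec k j) ≡ j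
inc-dec {k} {zero}  j≤k rewrite ≡ᵇ-refl k = refl
inc-dec {k} {suc j} j≤k rewrite ≡ᵇ-≢ (<⇒≢ j≤k) = refl

inc-< : ∀ {k j} → j < k → inc k j ≡ suc j
inc-< j<k rewrite ≡ᵇ-≢ (<⇒≢ j<k) = refl

relabel-∘ : ∀ f g x → relabel f (relabel g x) ≡ relabel (f ∘ g) x
relabel-∘ f g x = sym (map-∘ x)

relabel-id : ∀ f x → (∀ {j} → j ∈ map proj₁ x → f j ≡ j) → relabel f x ≡ x
relabel-id f []            h = refl
relabel-id f ((j , σ) ∷ x) h = cong₂ (λ i y → (i , σ) ∷ y) (h (here refl)) (relabel-id f x (h ∘ there))

labels-relabel : ∀ f x → map proj₁ (relabel f x) ≡ map f (map proj₁ x)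
labels-relabel f x = trans (sym (map-∘ x)) (map-∘ x)

relabel-valid : ∀ {m x} f → map f (upTo m) ↭ upTo m → Valid m x → Valid m (relabel f x)
relabel-valid {m} {x} f p v = ↭-trans (↭-reflexive (labels-relabel f x)) (↭-trans (Perm.map⁺ f v) p)

valid-< : ∀ {m x j} → Valid m x → j ∈ map proj₁ x → j < m
valid-< v i = ∈-upTo⁻ (Perm.∈-resp-↭ v i)

upTo-suc : ∀ k → upTo (suc k) ≡ 0 ∷ map suc (upTo k)
upTo-suc k = cong (0 ∷_) (sym (map-upTo suc k))

map-inc-upTo : ∀ k → map (inc k) (upTo (suc k)) ↭ upTo (suc k)
map-inc-upTo k = ↭-trans (↭-reflexive eq) (↭-trans (↭-sym (Perm.∷↭∷ʳ 0 (map suc (upTo k)))) (↭-reflexive (sym (upTo-suc k))))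
  where
  eq : map (inc k) (upTo (suc k)) ≡ map suc (upTo k) ∷ʳ 0
  eq = trans (cong (map (inc k)) (sym (upTo-∷ʳ k))) (trans (map-++ (inc k) (upTo k) [ k ])
    (cong₂ _++_ (map-cong-local (All.tabulate (λ i → inc-< (∈-upTo⁻ i)))) (cong (λ b → [ if b then 0 else suc k ]) (≡ᵇ-refl k))))

unshift-valid : ∀ {k x} → Valid (suc k) x → Valid (suc k) (unshift k x)
unshift-valid {k} = relabel-valid (inc k) (map-inc-upTo k)

map-dec-upTo : ∀ k → map (dec k) (upTo (suc k)) ↭ upTo (suc k)
map-dec-upTo k = ↭-trans (Perm.map⁺ (dec k) (↭-sym (map-inc-upTo k))) (↭-reflexive
  (trans (sym (map-∘ (upTo (suc k)))) (trans (map-cong (dec-inc k) (upTo (suc k))) (map-id (upTo (suc k))))))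

shift-valid : ∀ {k x} → Valid (suc k) x → Valid (suc k) (shift k x)
shift-valid {k} = relabel-valid (dec k) (map-dec-upTo k)

shift-unshift : ∀ k x → shift k (unshift k x) ≡ x
shift-unshift k x = trans (relabel-∘ _ _ x) (relabel-id _ x (λ {j} _ → dec-inc k j))

unshift-shift : ∀ {k x} → Valid (suc k) x → unshift k (shift k x) ≡ x
unshift-shift {k} {x} v = trans (relabel-∘ _ _ x) (relabel-id _ x (λ i → inc-dec (≤-pred (valid-< {x = x} v i))))

iterate-comm : {A : Set} (f : A → A) → ∀ i x → iterate f (f x) i ≡ f (iterate f x i)
iterate-comm f zero    x = refl
iterate-comm f (suc i) x = iterate-comm f i (f x)

iterate-cancel : {A : Set} (f g : A → A) → (∀ x → g (f x) ≡ x) → ∀ i x → iterate g (iterate f x i) i ≡ x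
iterate-cancel f g gf zero    x = refl
iterate-cancel f g gf (suc i) x = begin
  iterate g (g (iterate f (f x) i)) i  ≡⟨ cong (λ y → iterate g (g y) i) (iterate-comm f i x) ⟩
  iterate g (g (f (iterate f x i))) i  ≡⟨ cong (λ y → iterate g y i) (gf _) ⟩
  iterate g (iterate f x i) i          ≡⟨ iterate-cancel f g gf i x ⟩
  x                                    ∎
  where open ≡-Reasoning

iterate-preserves : {A : Set} (P : A → Set) {f : A → A} → (∀ {x} → P x → P (f x)) → ∀ i {x} → P x → P (iterate f x i)
iterate-preserves P p zero    h = h
iterate-preserves P p (suc i) h = iterate-preserves P p i (p h)

iterate-relabel : ∀ f i v σ z → iterate (relabel f) ((v , σ) ∷ z) i ≡ (iterate f v i , σ) ∷ iterate (relabel f) z i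
iterate-relabel f zero    v σ z = refl
iterate-relabel f (suc i) v σ z = iterate-relabel f i (f v) σ (relabel f z)

iterate-inc : ∀ k j i → i + j ≤ k → iterate (inc k) j i ≡ i + j
iterate-inc k j zero    le = refl
iterate-inc k j (suc i) le = begin
  iterate (inc k) (inc k j) i  ≡⟨ cong (λ h → iterate (inc k) h i) (inc-< (≤-trans (s≤s (m≤n+m j i)) le)) ⟩
  iterate (inc k) (suc j) i    ≡⟨ iterate-inc k (suc j) i (≤-trans (≤-reflexive (+-suc i j)) le) ⟩
  i + suc j                    ≡⟨ +-suc i j ⟩
  suc i + j                    ∎
  where open ≡-Reasoning

iterate-dec : ∀ k v → iterate (dec k) v v ≡ 0
iterate-dec k zero    = refl
iterate-dec k (suc v) = iterate-dec k v

rooted : List Stack → List Stack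
rooted ys = map (λ y → (0 , true) ∷ relabel suc y) ys ++ map (λ y → (0 , false) ∷ relabel suc y) ys

orbit : ℕ → List Stack → ℕ → List Stack
orbit k xs i = map (λ x → iterate (unshift k) x i) xs

-- Every signed arrangement is a rotation of one whose top label is 0.
opaque
  stacks : ℕ → List Stack
  stacks zero    = [ [] ]
  stacks (suc k) = concatMap (orbit k (rooted (stacks k))) (upTo (suc k))

relabel-suc-valid : ∀ {k σ y} → Valid k y → Valid (suc k) ((0 , σ) ∷ relabel suc y)
relabel-suc-valid {k} {σ} {y} v =
  ↭-trans (Perm.++⁺ˡ [ 0 ] (↭-trans (↭-reflexive (labels-relabel suc y)) (Perm.map⁺ suc v))) (↭-reflexive (sym (upTo-suc k)))

relabel-pred : ∀ {k σ z} → Valid (suc k) ((0 , σ) ∷ z) → Valid k (relabel pred z) × relabel suc (relabel pred z) ≡ z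
relabel-pred {k} {σ} {z} v = valid , trans (relabel-∘ _ _ z) (relabel-id _ z positive)
  where
  v′ : map proj₁ z ↭ map suc (upTo k)
  v′ = Perm.drop-∷ (↭-trans v (↭-reflexive (upTo-suc k)))
  positive : ∀ {j} → j ∈ map proj₁ z → suc (pred j) ≡ j
  positive i with _ , _ , refl ← ∈-map⁻ suc (Perm.∈-resp-↭ v′ i) = refl
  valid : Valid k (relabel pred z)
  valid = ↭-trans (↭-reflexive (labels-relabel pred z)) (↭-trans (Perm.map⁺ pred v′)
    (↭-reflexive (trans (sym (map-∘ (upTo k))) (map-id (upTo k)))))

∈-rooted⁻ : ∀ ys {x} → x ∈ rooted ys → ∃₂ λ σ y → y ∈ ys × x ≡ (0 , σ) ∷ relabel suc y
∈-rooted⁻ ys i with ∈-++⁻ (map (λ y → (0 , true) ∷ relabel suc y) ys) i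
... | inj₁ j with y , h , eq ← ∈-map⁻ _ j = true , y , h , eq
... | inj₂ j with y , h , eq ← ∈-map⁻ _ j = false , y , h , eq

∈-rooted⁺ : ∀ {ys y} σ → y ∈ ys → (0 , σ) ∷ relabel suc y ∈ rooted ys
∈-rooted⁺ true  i = ∈-++⁺ˡ (∈-map⁺ _ i)
∈-rooted⁺ {ys} false i = ∈-++⁺ʳ (map (λ y → (0 , true) ∷ relabel suc y) ys) (∈-map⁺ _ i)

opaque
  unfolding stacks

  stacks⁻ : ∀ k {x} → x ∈ stacks k → Valid k x
  stacks⁻ zero    (here refl) = ↭-refl
  stacks⁻ (suc k) i
    with xs , x∈xs , xs∈ ← ∈-concat⁻′ (map (orbit k (rooted (stacks k))) (upTo (suc k))) i
    with i , _ , refl ← ∈-map⁻ (orbit k (rooted (stacks k))) {xs = upTo (suc k)} xs∈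
    with x , x∈ , refl ← ∈-map⁻ (λ x → iterate (unshift k) x i) x∈xs
    with σ , y , y∈ , refl ← ∈-rooted⁻ (stacks k) x∈
    = iterate-preserves (Valid (suc k)) (λ {x} → unshift-valid {k} {x}) i {(0 , σ) ∷ relabel suc y} (relabel-suc-valid {σ = σ} {y} (stacks⁻ k y∈))

unshift-shift-iterate : ∀ k i x → Valid (suc k) x → iterate (unshift k) (iterate (shift k) x i) i ≡ x
unshift-shift-iterate k zero    x v = refl
unshift-shift-iterate k (suc i) x v = begin
  iterate (unshift k) (unshift k (iterate (shift k) (shift k x) i)) i
    ≡⟨ iterate-comm (unshift k) i _ ⟩
  unshift k (iterate (unshift k) (iterate (shift k) (shift k x) i) i)
    ≡⟨ cong (unshift k) (unshift-shift-iterate k i (shift k x) (shift-valid {x = x} v)) ⟩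
  unshift k (shift k x)
    ≡⟨ unshift-shift {x = x} v ⟩
  x ∎
  where open ≡-Reasoning

-- As many shifts as the top label says bring it to `0`. `stacks⁺` reads off the orbit from this
-- normal form, and `cost` removes the top block from it.
rotated : ∀ {k v σ z} → Valid (suc k) ((v , σ) ∷ z) →
          iterate (shift k) ((v , σ) ∷ z) v ≡ (0 , σ) ∷ iterate (shift k) z v ×
          Valid (suc k) ((0 , σ) ∷ iterate (shift k) z v)
rotated {k} {v} {σ} {z} val = eq , subst (Valid (suc k)) eq (iterate-preserves (Valid (suc k)) (λ {x} → shift-valid {k} {x}) v {(v , σ) ∷ z} val)
  where eq = trans (iterate-relabel (dec k) v v σ z) (cong (λ j → (j , σ) ∷ iterate (shift k) z v) (iterate-dec k v))

opaque
  unfolding stacks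

  stacks⁺ : ∀ k {x} → Valid k x → x ∈ stacks k
  stacks⁺ zero    {[]}    v = here refl
  stacks⁺ zero    {_ ∷ _} v = contradiction v Perm.¬x∷xs↭[]
  stacks⁺ (suc k) {[]}    v = contradiction (↭-sym v) Perm.¬x∷xs↭[]
  stacks⁺ (suc k) {(v , σ) ∷ z} val
    with eq , val₀ ← rotated {k} {v} {σ} {z} val
    with val₁ , eq₁ ← relabel-pred {k} {σ} {iterate (shift k) z v} val₀
    = ∈-concat⁺′ (subst (_∈ orbit k (rooted (stacks k)) v) back (∈-map⁺ (λ x → iterate (unshift k) x v) (∈-rooted⁺ σ (stacks⁺ k val₁))))
                 (∈-map⁺ (orbit k (rooted (stacks k))) {xs = upTo (suc k)} (∈-upTo⁺ (valid-< {x = (v , σ) ∷ z} val (here refl))))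
    where
    back : iterate (unshift k) ((0 , σ) ∷ relabel suc (relabel pred (iterate (shift k) z v))) v ≡ (v , σ) ∷ z
    back = trans (cong (λ y → iterate (unshift k) ((0 , σ) ∷ y) v) eq₁)
          (trans (cong (λ y → iterate (unshift k) y v) (sym eq)) (unshift-shift-iterate k v _ val))

relabel-suc-injective : ∀ {x y} → relabel suc x ≡ relabel suc y → x ≡ y
relabel-suc-injective {x} {y} eq = trans (sym (cancel x)) (trans (cong (relabel pred) eq) (cancel y))
  where
  cancel : ∀ x → relabel pred (relabel suc x) ≡ x
  cancel x = trans (relabel-∘ _ _ x) (relabel-id _ x (λ _ → refl))

rooted-unique : ∀ {ys} → Unique ys → Unique (rooted ys)
rooted-unique {ys} u = Unique.++⁺ (half true) (half false) different
  where
  half : ∀ σ → Unique (map (λ y → (0 , σ) ∷ relabel suc y) ys)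
  half σ = Unique.map⁺ (relabel-suc-injective ∘ ∷-injectiveʳ) u
  different : Disjoint (map (λ y → (0 , true) ∷ relabel suc y) ys) (map (λ y → (0 , false) ∷ relabel suc y) ys)
  different (i , j) with _ , _ , refl ← ∈-map⁻ _ i | _ , _ , () ← ∈-map⁻ _ j

opaque
  unfolding stacks

  -- Orbits are disjoint because the `i`-th rotation of a stack with top label `0` has top label
  -- `i`.
  stacks-unique : ∀ k → Unique (stacks k)
  stacks-unique zero    = [] ∷ []
  stacks-unique (suc k) = Unique.concat⁺ (All.map⁺ {xs = upTo (suc k)} {f = orbit k (rooted (stacks k))} (All.tabulate λ {i} _ → Unique.map⁺ {f = λ x → iterate (unshift k) x i} (λ {x} {y} → injective i {x} {y}) (rooted-unique (stacks-unique k))))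
    (AllPairs.map⁺ {xs = upTo (suc k)} (AllPairs-map-∈ (upTo (suc k)) disjoint (Unique.upTo⁺ (suc k))))
    where
    injective : ∀ i {x y} → iterate (unshift k) x i ≡ iterate (unshift k) y i → x ≡ y
    injective i {x} {y} eq = trans (sym (cancel x)) (trans (cong (λ z → iterate (shift k) z i) eq) (cancel y))
      where
      cancel : ∀ x → iterate (shift k) (iterate (unshift k) x i) i ≡ x
      cancel = iterate-cancel (unshift k) (shift k) (shift-unshift k) i
    top : ∀ {i x} → i ≤ k → x ∈ orbit k (rooted (stacks k)) i → ∃₂ λ σ z → x ≡ (i , σ) ∷ z
    top {i} i≤k x∈ with x , x∈ , refl ← ∈-map⁻ (λ x → iterate (unshift k) x i) x∈ with σ , y , _ , refl ← ∈-rooted⁻ (stacks k) x∈ = σ , _ ,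
      trans (iterate-relabel (inc k) i 0 σ (relabel suc y))
            (cong (λ j → (j , σ) ∷ iterate (unshift k) (relabel suc y) i) (trans (iterate-inc k 0 i (≤-trans (≤-reflexive (+-identityʳ i)) i≤k)) (+-identityʳ i)))
    disjoint : ∀ {i j} → i ∈ upTo (suc k) → j ∈ upTo (suc k) → i ≢ j → Disjoint (orbit k (rooted (stacks k)) i) (orbit k (rooted (stacks k)) j)
    disjoint i∈ j∈ i≢j (p , q) with _ , _ , eq ← top (≤-pred (∈-upTo⁻ i∈)) p with _ , _ , eq′ ← top (≤-pred (∈-upTo⁻ j∈)) q =
      i≢j (cong proj₁ (∷-injectiveˡ (trans (sym eq) eq′)))

opaque
  unfolding stacks

  -- A uniform signed arrangement is a uniform top label, a uniform top sign and an independent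
  -- uniform arrangement of the rest. `cost` recurses along exactly this decomposition.
  ∑-stacks : ∀ k (f : Stack → ℕ) →
    ∑ (stacks (suc k)) f ≡
    ∑ (upTo (suc k)) (λ i → ∑ (stacks k) (λ y → f (iterate (unshift k) ((0 , true) ∷ relabel suc y) i)) +
                            ∑ (stacks k) (λ y → f (iterate (unshift k) ((0 , false) ∷ relabel suc y) i)))
  ∑-stacks k f = trans (∑-concatMap (orbit k (rooted (stacks k))) (upTo (suc k)) f) (∑-cong (upTo (suc k)) λ i →
    trans (∑-map (λ x → iterate (unshift k) x i) (rooted (stacks k)) f)
    (trans (∑-++ (map (λ y → (0 , true) ∷ relabel suc y) (stacks k)) _ _)
           (cong₂ _+_ (∑-map _ (stacks k) _) (∑-map _ (stacks k) _))))

count : ℕ → ℕ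
count k = length (stacks k)

opaque
  unfolding stacks

  count-zero : count 0 ≡ 1
  count-zero = refl

∑-stacks-const : ∀ k c → ∑ (stacks k) (λ _ → c) ≡ count k * c
∑-stacks-const k c = ∑-const c (stacks k)

count-suc : ∀ k → count (suc k) ≡ suc k * (2 * count k)
count-suc k = begin
  count (suc k)                                   ≡⟨ *-identityʳ _ ⟨
  count (suc k) * 1                               ≡⟨ ∑-const 1 (stacks (suc k)) ⟨
  ∑ (stacks (suc k)) (λ _ → 1)                    ≡⟨ ∑-stacks k (λ _ → 1) ⟩
  ∑ (upTo (suc k)) (λ _ → S + S)                  ≡⟨ ∑-const (S + S) (upTo (suc k)) ⟩
  length (upTo (suc k)) * (S + S)                 ≡⟨ cong₂ _*_ (length-upTo (suc k)) (cong₂ _+_ S≡ (trans S≡ (sym (+-identityʳ _)))) ⟩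
  suc k * (2 * count k)                           ∎
  where
  open ≡-Reasoning
  S = ∑ (stacks k) (λ _ → 1)
  S≡ : S ≡ count k
  S≡ = trans (∑-const 1 (stacks k)) (*-identityʳ _)

∑-stacks-bijection : ∀ k (φ ψ : Stack → Stack) →
  (∀ {x} → Valid k x → Valid k (φ x)) → (∀ {x} → Valid k x → Valid k (ψ x)) →
  (∀ {x} → Valid k x → ψ (φ x) ≡ x) → (∀ {x} → Valid k x → φ (ψ x) ≡ x) →
  (f : Stack → ℕ) → ∑ (stacks k) (f ∘ φ) ≡ ∑ (stacks k) f
∑-stacks-bijection k φ ψ vφ vψ ψφ φψ =
  ∑-bijection (stacks k) (stacks-unique k) φ ψ (stacks⁺ k ∘ vφ ∘ stacks⁻ k) (stacks⁺ k ∘ vψ ∘ stacks⁻ k) (ψφ ∘ stacks⁻ k) (φψ ∘ stacks⁻ k)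

∑-stacks-involution : ∀ k (φ : Stack → Stack) →
  (∀ {x} → Valid k x → Valid k (φ x)) → (∀ {x} → Valid k x → φ (φ x) ≡ x) →
  (f : Stack → ℕ) → ∑ (stacks k) (f ∘ φ) ≡ ∑ (stacks k) f
∑-stacks-involution k φ v i = ∑-stacks-bijection k φ φ v v i i

∑-stacks-cong : ∀ k {f g : Stack → ℕ} → (∀ {x} → Valid k x → f x ≡ g x) → ∑ (stacks k) f ≡ ∑ (stacks k) g
∑-stacks-cong k eq = ∑-cong-∈ (stacks k) (eq ∘ stacks⁻ k)

-- Signs, turning over, and the relative order of two blocks.

sign : ℕ → Stack → Bool
sign a []            = true
sign a ((j , τ) ∷ y) = if j ≡ᵇ a then τ else sign a y

resign : (ℕ × Bool → Bool) → Stack → Stack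
resign f = map (λ p → proj₁ p , f p)

setSign : ℕ → Bool → Stack → Stack
setSign a b = resign (λ p → if proj₁ p ≡ᵇ a then b else proj₂ p)

toggle : ℕ → Stack → Stack
toggle a = resign (λ p → if proj₁ p ≡ᵇ a then not (proj₂ p) else proj₂ p)

turn : Stack → Stack
turn x = reverse (map (map₂ not) x)

flipOnto : Stack → ℕ → Stack → Stack
flipOnto acc a []            = acc
flipOnto acc a ((j , τ) ∷ y) = if j ≡ᵇ a then acc ++ (j , τ) ∷ y else flipOnto ((j , not τ) ∷ acc) a y

-- What happens to the rest of the stack when the top block lands just above block `a`: everything
-- strictly above `a` is turned over, `a` itself stays.
flipTo : ℕ → Stack → Stack
flipTo = flipOnto []

above : ℕ → ℕ → Stack → Bool
above b a []            = false
above b a ((j , _) ∷ y) = if j ≡ᵇ b then true else if j ≡ᵇ a then false else above b a y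

labels : Stack → List ℕ
labels = map proj₁

data Split (a : ℕ) : Stack → Set where
  split : ∀ A τ D → a ∉ labels A → a ∉ labels D → Split a (A ++ (a , τ) ∷ D)

labels-turn : ∀ A → labels (turn A) ↭ labels A
labels-turn A = ↭-trans (Perm.map⁺ proj₁ (Perm.↭-reverse (map (map₂ not) A))) (↭-reflexive (sym (map-∘ A)))

∉-turn : ∀ {a} A → a ∉ labels A → a ∉ labels (turn A)
∉-turn A a∉ i = a∉ (Perm.∈-resp-↭ (labels-turn A) i)

turn-++ : ∀ A B → turn (A ++ B) ≡ turn B ++ turn A
turn-++ A B = trans (cong reverse (map-++ (map₂ not) A B)) (reverse-++ (map (map₂ not) A) (map (map₂ not) B))

turn-involutive : ∀ A → turn (turn A) ≡ A
turn-involutive A = begin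
  reverse (map (map₂ not) (reverse (map (map₂ not) A)))  ≡⟨ cong reverse (reverse-map (map₂ not) (map (map₂ not) A)) ⟩
  reverse (reverse (map (map₂ not) (map (map₂ not) A)))  ≡⟨ reverse-involutive _ ⟩
  map (map₂ not) (map (map₂ not) A)                      ≡⟨ map-∘ A ⟨
  map (map₂ (not ∘ not)) A                               ≡⟨ map-cong (λ p → cong (proj₁ p ,_) (not-involutive (proj₂ p))) A ⟩
  map id A                                               ≡⟨ map-id A ⟩
  A                                                      ∎
  where open ≡-Reasoning

flipOnto-split : ∀ acc {a τ} A D → a ∉ labels A → flipOnto acc a (A ++ (a , τ) ∷ D) ≡ (turn A ++ acc) ++ (a , τ) ∷ D
flipOnto-split acc {a} []            D a∉ rewrite ≡ᵇ-refl a = refl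
flipOnto-split acc {a} {τ} ((j , ρ) ∷ A) D a∉ rewrite ≡ᵇ-≢ {j} {a} (λ eq → a∉ (here (sym eq))) = begin
  flipOnto ((j , not ρ) ∷ acc) a (A ++ (a , τ) ∷ D)     ≡⟨ flipOnto-split _ A D (a∉ ∘ there) ⟩
  (turn A ++ (j , not ρ) ∷ acc) ++ (a , τ) ∷ D          ≡⟨ cong (_++ (a , τ) ∷ D) (++-assoc (turn A) [ (j , not ρ) ] acc) ⟨
  ((turn A ++ [ (j , not ρ) ]) ++ acc) ++ (a , τ) ∷ D   ≡⟨ cong (λ B → (B ++ acc) ++ (a , τ) ∷ D) (turn-++ [ (j , ρ) ] A) ⟨
  (turn ((j , ρ) ∷ A) ++ acc) ++ (a , τ) ∷ D            ∎
  where open ≡-Reasoning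

flipTo-split : ∀ {a τ} A D → a ∉ labels A → flipTo a (A ++ (a , τ) ∷ D) ≡ turn A ++ (a , τ) ∷ D
flipTo-split {a} {τ} A D a∉ = trans (flipOnto-split [] A D a∉) (cong (_++ (a , τ) ∷ D) (++-identityʳ (turn A)))

sign-∉ : ∀ {a} A D → a ∉ labels A → sign a (A ++ D) ≡ sign a D
sign-∉         []            D a∉ = refl
sign-∉ {a} ((j , ρ) ∷ A) D a∉ rewrite ≡ᵇ-≢ {j} {a} (λ eq → a∉ (here (sym eq))) = sign-∉ A D (a∉ ∘ there)

sign-split : ∀ {a τ} A D → a ∉ labels A → sign a (A ++ (a , τ) ∷ D) ≡ τ
sign-split {a} {τ} A D a∉ = trans (sign-∉ A ((a , τ) ∷ D) a∉) (cong (λ b → if b then τ else sign a D) (≡ᵇ-refl a))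

resign-∉ : ∀ {a} (f : ℕ × Bool → Bool) A → a ∉ labels A → resign (λ p → if proj₁ p ≡ᵇ a then f p else proj₂ p) A ≡ A
resign-∉     f []            a∉ = refl
resign-∉ {a} f ((j , ρ) ∷ A) a∉ rewrite ≡ᵇ-≢ {j} {a} (λ eq → a∉ (here (sym eq))) = cong ((j , ρ) ∷_) (resign-∉ f A (a∉ ∘ there))

resign-split : ∀ {a τ} (f : ℕ × Bool → Bool) A D → a ∉ labels A → a ∉ labels D →
               resign (λ p → if proj₁ p ≡ᵇ a then f p else proj₂ p) (A ++ (a , τ) ∷ D) ≡ A ++ (a , f (a , τ)) ∷ D
resign-split {a} {τ} f A D a∉A a∉D = trans (map-++ _ A ((a , τ) ∷ D))
  (cong₂ _++_ (resign-∉ f A a∉A) (cong₂ (λ b E → (a , (if b then f (a , τ) else τ)) ∷ E) (≡ᵇ-refl a) (resign-∉ f D a∉D)))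

setSign-split : ∀ {a b τ} A D → a ∉ labels A → a ∉ labels D → setSign a b (A ++ (a , τ) ∷ D) ≡ A ++ (a , b) ∷ D
setSign-split {b = b} = resign-split (λ _ → b)

toggle-split : ∀ {a τ} A D → a ∉ labels A → a ∉ labels D → toggle a (A ++ (a , τ) ∷ D) ≡ A ++ (a , not τ) ∷ D
toggle-split = resign-split (not ∘ proj₂)

labels-resign : ∀ f x → labels (resign f x) ≡ labels x
labels-resign f x = sym (map-∘ x)

resign-valid : ∀ {m} f {x} → Valid m x → Valid m (resign f x)
resign-valid f {x} v = ↭-trans (↭-reflexive (labels-resign f x)) v

reverse-valid : ∀ {m x} → Valid m x → Valid m (reverse x)
reverse-valid {x = x} v = ↭-trans (Perm.map⁺ proj₁ (Perm.↭-reverse x)) v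

valid-unique : ∀ {m x} → Valid m x → Unique (labels x)
valid-unique {m} v = Unique-resp-↭ (setoid ℕ) (↭⇒↭ₛ (↭-sym v)) (Unique.upTo⁺ m)

split-unique : ∀ {a x} → Unique (labels x) → a ∈ labels x → Split a x
split-unique {a} {(j , τ) ∷ x} (j∉ ∷ u) (here refl) = split [] τ x (λ ()) (λ i → All.lookup j∉ i refl)
split-unique {a} {(j , τ) ∷ x} (j∉ ∷ u) (there i) with split-unique u i
... | split A ρ D a∉A a∉D = split ((j , τ) ∷ A) ρ D (λ { (here refl) → All.lookup j∉ i refl ; (there h) → a∉A h }) a∉D

valid-split : ∀ {m a x} → Valid m x → a < m → Split a x
valid-split {x = x} v a<m = split-unique (valid-unique {x = x} v) (Perm.∈-resp-↭ (↭-sym v) (∈-upTo⁺ a<m))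

flipTo-labels : ∀ {a x} → Split a x → labels (flipTo a x) ↭ labels x
flipTo-labels {a} (split A τ D a∉A _) =
  ↭-trans (↭-reflexive (trans (cong labels (flipTo-split A D a∉A)) (map-++ proj₁ (turn A) _)))
  (↭-trans (Perm.++⁺ʳ _ (labels-turn A)) (↭-reflexive (sym (map-++ proj₁ A _))))

flipTo-valid : ∀ {m a x} → a < m → Valid m x → Valid m (flipTo a x)
flipTo-valid {x = x} a<m v = ↭-trans (flipTo-labels (valid-split {x = x} v a<m)) v

flipTo-involutive : ∀ {a x} → Split a x → flipTo a (flipTo a x) ≡ x
flipTo-involutive {a} (split A τ D a∉A _) = begin
  flipTo a (flipTo a (A ++ (a , τ) ∷ D))  ≡⟨ cong (flipTo a) (flipTo-split A D a∉A) ⟩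
  flipTo a (turn A ++ (a , τ) ∷ D)        ≡⟨ flipTo-split (turn A) D (∉-turn A a∉A) ⟩
  turn (turn A) ++ (a , τ) ∷ D            ≡⟨ cong (_++ (a , τ) ∷ D) (turn-involutive A) ⟩
  A ++ (a , τ) ∷ D                        ∎
  where open ≡-Reasoning

sign-flipTo : ∀ {a x} → Split a x → sign a (flipTo a x) ≡ sign a x
sign-flipTo {a} (split A τ D a∉A _) = begin
  sign a (flipTo a (A ++ (a , τ) ∷ D))  ≡⟨ cong (sign a) (flipTo-split A D a∉A) ⟩
  sign a (turn A ++ (a , τ) ∷ D)        ≡⟨ sign-split (turn A) D (∉-turn A a∉A) ⟩
  τ                                     ≡⟨ sign-split A D a∉A ⟨
  sign a (A ++ (a , τ) ∷ D)             ∎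
  where open ≡-Reasoning

flipTo-setSign : ∀ {a x} b → Split a x → flipTo a (setSign a b x) ≡ setSign a b (flipTo a x)
flipTo-setSign {a} b (split A τ D a∉A a∉D) = begin
  flipTo a (setSign a b (A ++ (a , τ) ∷ D))  ≡⟨ cong (flipTo a) (setSign-split A D a∉A a∉D) ⟩
  flipTo a (A ++ (a , b) ∷ D)                ≡⟨ flipTo-split A D a∉A ⟩
  turn A ++ (a , b) ∷ D                      ≡⟨ setSign-split (turn A) D (∉-turn A a∉A) a∉D ⟨
  setSign a b (turn A ++ (a , τ) ∷ D)        ≡⟨ cong (setSign a b) (flipTo-split A D a∉A) ⟨
  setSign a b (flipTo a (A ++ (a , τ) ∷ D))  ∎
  where open ≡-Reasoning

toggle-involutive : ∀ {a x} → Split a x → toggle a (toggle a x) ≡ x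
toggle-involutive {a} (split A τ D a∉A a∉D) = begin
  toggle a (toggle a (A ++ (a , τ) ∷ D))  ≡⟨ cong (toggle a) (toggle-split A D a∉A a∉D) ⟩
  toggle a (A ++ (a , not τ) ∷ D)         ≡⟨ toggle-split A D a∉A a∉D ⟩
  A ++ (a , not (not τ)) ∷ D              ≡⟨ cong (λ ρ → A ++ (a , ρ) ∷ D) (not-involutive τ) ⟩
  A ++ (a , τ) ∷ D                        ∎
  where open ≡-Reasoning

sign-toggle : ∀ {a x} → Split a x → sign a (toggle a x) ≡ not (sign a x)
sign-toggle {a} (split A τ D a∉A a∉D) = trans (cong (sign a) (toggle-split A D a∉A a∉D))
  (trans (sign-split A D a∉A) (cong not (sym (sign-split A D a∉A))))

sign-toggle-≢ : ∀ {a b} x → a ≢ b → sign b (toggle a x) ≡ sign b x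
sign-toggle-≢         []            a≢b = refl
sign-toggle-≢ {a} {b} ((j , τ) ∷ x) a≢b with j ≟ a
... | yes refl rewrite ≡ᵇ-≢ a≢b = sign-toggle-≢ x a≢b
... | no j≢a rewrite ≡ᵇ-≢ j≢a with j ≡ᵇ b
...   | true  = refl
...   | false = sign-toggle-≢ x a≢b

sign-setSign : ∀ {a x} b → Split a x → sign a (setSign a b x) ≡ b
sign-setSign {a} b (split A τ D a∉A a∉D) = trans (cong (sign a) (setSign-split A D a∉A a∉D)) (sign-split A D a∉A)

-- One of the two assigned values is the present sign and the other its opposite; only their order
-- depends on the stack.
setSign-pair : ∀ {a x} (g : Stack → ℕ) → Split a x → g (setSign a true x) + g (setSign a false x) ≡ g x + g (toggle a x)
setSign-pair {a} g (split A τ D a∉A a∉D)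
  rewrite setSign-split {a} {true} {τ} A D a∉A a∉D | setSign-split {a} {false} {τ} A D a∉A a∉D | toggle-split {a} {τ} A D a∉A a∉D
  with τ
... | true  = refl
... | false = +-comm (g (A ++ (a , true) ∷ D)) _

∉-reverse : ∀ {a} A → a ∉ labels A → a ∉ labels (reverse A)
∉-reverse A a∉ i = a∉ (Perm.∈-resp-↭ (Perm.map⁺ proj₁ (Perm.↭-reverse A)) i)

sign-reverse : ∀ {a x} → Split a x → sign a (reverse x) ≡ sign a x
sign-reverse {a} (split A τ D a∉A a∉D) = begin
  sign a (reverse (A ++ (a , τ) ∷ D))                ≡⟨ cong (sign a) (reverse-++ A ((a , τ) ∷ D)) ⟩
  sign a (reverse ((a , τ) ∷ D) ++ reverse A)        ≡⟨ cong (λ E → sign a (E ++ reverse A)) (reverse-++ [ (a , τ) ] D) ⟩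
  sign a ((reverse D ++ [ (a , τ) ]) ++ reverse A)   ≡⟨ cong (sign a) (++-assoc (reverse D) _ _) ⟩
  sign a (reverse D ++ (a , τ) ∷ reverse A)          ≡⟨ sign-split (reverse D) (reverse A) (∉-reverse D a∉D) ⟩
  τ                                                  ≡⟨ sign-split A D a∉A ⟨
  sign a (A ++ (a , τ) ∷ D)                          ∎
  where open ≡-Reasoning

above-∉ : ∀ {a b} A D → a ∉ labels A → b ∉ labels A → above b a (A ++ D) ≡ above b a D
above-∉         []            D a∉ b∉ = refl
above-∉ {a} {b} ((j , _) ∷ A) D a∉ b∉
  rewrite ≡ᵇ-≢ {j} {a} (λ eq → a∉ (here (sym eq))) | ≡ᵇ-≢ {j} {b} (λ eq → b∉ (here (sym eq))) = above-∉ A D (a∉ ∘ there) (b∉ ∘ there)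

above-yes : ∀ {a b τ} A D → a ∉ labels A → b ∉ labels A → above b a (A ++ (b , τ) ∷ D) ≡ true
above-yes {a} {b} A D a∉ b∉ = trans (above-∉ A _ a∉ b∉) (cong (λ c → if c then true else (if b ≡ᵇ a then false else above b a D)) (≡ᵇ-refl b))

above-no : ∀ {a b τ} A D → a ≢ b → a ∉ labels A → b ∉ labels A → above b a (A ++ (a , τ) ∷ D) ≡ false
above-no {a} {b} A D a≢b a∉ b∉ = trans (above-∉ A _ a∉ b∉)
  (trans (cong (λ c → if c then true else (if a ≡ᵇ a then false else above b a D)) (≡ᵇ-≢ a≢b)) (cong (λ c → if c then false else above b a D) (≡ᵇ-refl a)))

data Order (b a : ℕ) : Stack → Set where
  upper : ∀ A τ M ρ D → a ∉ labels A → b ∉ labels A → a ∉ labels M → b ∉ labels M → a ∉ labels D → b ∉ labels D →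
          Order b a (A ++ (b , τ) ∷ M ++ (a , ρ) ∷ D)
  lower : ∀ A τ M ρ D → a ∉ labels A → b ∉ labels A → a ∉ labels M → b ∉ labels M → a ∉ labels D → b ∉ labels D →
          Order b a (A ++ (a , τ) ∷ M ++ (b , ρ) ∷ D)

∉-++ˡ : ∀ {a} A {D} → a ∉ labels (A ++ D) → a ∉ labels A
∉-++ˡ A a∉ i = a∉ (subst (_ ∈_) (sym (map-++ proj₁ A _)) (∈-++⁺ˡ i))

∉-++ʳ : ∀ {a} A {D} → a ∉ labels (A ++ D) → a ∉ labels D
∉-++ʳ A a∉ i = a∉ (subst (_ ∈_) (sym (map-++ proj₁ A _)) (∈-++⁺ʳ (labels A) i))

order-unique : ∀ {a b x} → a ≢ b → Unique (labels x) → a ∈ labels x → b ∈ labels x → Order b a x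
order-unique {x = (j , τ) ∷ x} a≢b (j∉ ∷ u) (here refl) (here refl) = contradiction refl a≢b
order-unique {x = (j , τ) ∷ x} a≢b (j∉ ∷ u) (here refl) (there ib) with split-unique u ib
... | split A ρ D b∉A b∉D = lower [] τ A ρ D (λ ()) (λ ()) (∉-++ˡ A a∉) b∉A (∉-++ʳ A a∉ ∘ there) b∉D
  where a∉ = λ i → All.lookup j∉ i refl
order-unique {x = (j , τ) ∷ x} a≢b (j∉ ∷ u) (there ia) (here refl) with split-unique u ia
... | split A ρ D a∉A a∉D = upper [] τ A ρ D (λ ()) (λ ()) a∉A (∉-++ˡ A b∉) a∉D (∉-++ʳ A b∉ ∘ there)
  where b∉ = λ i → All.lookup j∉ i refl
order-unique {x = (j , τ) ∷ x} a≢b (j∉ ∷ u) (there ia) (there ib) with order-unique a≢b u ia ib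
... | upper A ρ M π D p q r s t v = upper ((j , τ) ∷ A) ρ M π D
  (λ { (here refl) → All.lookup j∉ ia refl ; (there h) → p h }) (λ { (here refl) → All.lookup j∉ ib refl ; (there h) → q h }) r s t v
... | lower A ρ M π D p q r s t v = lower ((j , τ) ∷ A) ρ M π D
  (λ { (here refl) → All.lookup j∉ ia refl ; (there h) → p h }) (λ { (here refl) → All.lookup j∉ ib refl ; (there h) → q h }) r s t v

valid-order : ∀ {m a b x} → a ≢ b → a < m → b < m → Valid m x → Order b a x
valid-order {x = x} a≢b a< b< v = order-unique a≢b (valid-unique {x = x} v) (Perm.∈-resp-↭ (↭-sym v) (∈-upTo⁺ a<)) (Perm.∈-resp-↭ (↭-sym v) (∈-upTo⁺ b<))

reverse-two : ∀ (A : Stack) p M q D → reverse (A ++ p ∷ M ++ q ∷ D) ≡ reverse D ++ q ∷ reverse M ++ p ∷ reverse A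
reverse-two A p M q D = begin
  reverse (A ++ p ∷ M ++ q ∷ D)                    ≡⟨ one A p (M ++ q ∷ D) ⟩
  reverse (M ++ q ∷ D) ++ p ∷ reverse A            ≡⟨ cong (_++ p ∷ reverse A) (one M q D) ⟩
  (reverse D ++ q ∷ reverse M) ++ p ∷ reverse A    ≡⟨ ++-assoc (reverse D) _ _ ⟩
  reverse D ++ q ∷ reverse M ++ p ∷ reverse A      ∎
  where
  open ≡-Reasoning
  one : ∀ (A : Stack) p D → reverse (A ++ p ∷ D) ≡ reverse D ++ p ∷ reverse A
  one A p D = trans (reverse-++ A (p ∷ D)) (trans (cong (_++ reverse A) (reverse-++ [ p ] D)) (++-assoc (reverse D) [ p ] (reverse A)))

above-reverse : ∀ {a b x} → a ≢ b → Order b a x → above b a (reverse x) ≡ not (above b a x)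
above-reverse {a} {b} a≢b (upper A τ M ρ D p q r s t v) =
  trans (cong (above b a) (reverse-two A (b , τ) M (a , ρ) D))
  (trans (above-no (reverse D) _ a≢b (∉-reverse D t) (∉-reverse D v)) (cong not (sym (above-yes A _ p q))))
above-reverse {a} {b} a≢b (lower A τ M ρ D p q r s t v) =
  trans (cong (above b a) (reverse-two A (a , τ) M (b , ρ) D))
  (trans (above-yes (reverse D) _ (∉-reverse D t) (∉-reverse D v)) (cong not (sym (above-no A _ a≢b p q))))

-- Turning over what lies above `b` does not reach `a` further down. This makes the two-flip landing
-- in `blocks` reversible: with `a` above `b` the sign of `a` would change and the image would
-- collide with that of another case.
above-flipTo : ∀ {a b x} → a ≢ b → Order b a x → above b a x ≡ true →
               sign a (flipTo b x) ≡ sign a x × above b a (flipTo b x) ≡ true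
above-flipTo {a} {b} a≢b (lower A τ M ρ D p q r s t v) h = contradiction (trans (sym h) (above-no A _ a≢b p q)) λ ()
above-flipTo {a} {b} a≢b (upper A τ M ρ D p q r s t v) h =
  trans (cong (sign a) eq) (trans (sign-∉ (turn A) _ (∉-turn A p)) (sym (sign-∉ A _ p))) ,
  trans (cong (above b a) eq) (above-yes (turn A) _ (∉-turn A p) (∉-turn A q))
  where eq = flipTo-split A (M ++ (a , ρ) ∷ D) q

-- The algorithm

-- A single pancake wants to be joined to its neighbour in direction s (true: right, false: left); a block wants nothing.
data Type : Set where
  one : Bool → Type
  blk : Type

Word : Set
Word = List Type

nth : {A : Set} → A → List A → ℕ → A
nth d []       j       = d
nth d (x ∷ xs) zero    = x
nth d (x ∷ xs) (suc j) = nth d xs j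

update : {A : Set} → ℕ → (A → A) → List A → List A
update j       f []       = []
update zero    f (x ∷ xs) = f x ∷ xs
update (suc j) f (x ∷ xs) = x ∷ update j f xs

rotate : {A : Set} → List A → List A
rotate []       = []
rotate (x ∷ xs) = xs ∷ʳ x

infix 4 _==_
_==_ : Bool → Bool → Bool
true  == b = b
false == b = not b

-- Once the top block is removed and the labels are rotated, its cyclic neighbours are the first and the last of the other k labels.
side : ℕ → Bool → ℕ
side k true  = 0
side k false = pred k

-- The top block is joined to its neighbour in direction s by landing above it if the neighbour has sign s (1 flip, when
-- the top block has sign not s), or below it if the neighbour has sign not s (2 flips, when the top block has sign s).
-- Turning over the top block first costs 1 more flip, and a single pancake has whichever sign is needed.
data Rule : Set where
  pair single extend : Bool → Rule
  blocks             : Rule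

-- Only a neighbour that wants the opposite direction is the partner; one that wants the same
-- direction is treated like a block, with its sign as given.
oneRule : Bool → Type → Rule
oneRule s (one r) = if s == r then single s else pair s
oneRule s blk     = single s

-- A single neighbour is preferred because it costs 3/2 flips instead of 13/8; of two single
-- neighbours the right one is taken.
blkRule : Type → Type → Rule
blkRule (one _) _       = extend true
blkRule blk     (one _) = extend false
blkRule blk     blk     = blocks

rule : ℕ → Type → Word → Rule
rule k (one s) V = oneRule s (nth blk V (side k s))
rule k blk     V = blkRule (nth blk V (side k true)) (nth blk V (side k false))

-- For `blocks` the word stays: its top letter is already dropped, and whichever neighbour absorbs
-- the top block is a block anyway. So the next word does not depend on the stack, although the
-- direction of the join does.
after : ℕ → Rule → Word → Word
after k (pair s)   V = update (side k s) (λ _ → blk) V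
after k (single s) V = update (side k s) (λ _ → blk) V
after k (extend s) V = update (side k s) (λ _ → blk) V
after k blocks     V = V

price : ℕ → Rule → Bool → Stack → ℕ
price k (pair s)   σ y = 1
price k (single s) σ y = if sign (side k s) y == s then 1 else 2
price k (extend s) σ y = if σ == s then 2 else 1
price k blocks     σ y =
  if sign (side k (not σ)) y == not σ then 1
  else if sign (side k σ) y == not σ then 2
  -- Both neighbours have sign `σ`, so the top block is turned over first. Landing above `side k σ`
  -- then costs 1 more flip and landing below `side k (not σ)` costs 2. The cheaper landing is used
  -- only where it spares the other neighbour, so that `move` stays reversible.
  else if above (side k σ) (side k (not σ)) y then 2 else 3

move : ℕ → Rule → Bool → Stack → Stack
move k (pair s)   σ y = flipTo (side k s) (setSign (side k s) s y)
move k (single s) σ y = if sign (side k s) y == s then flipTo (side k s) y else y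
move k (extend s) σ y =
  if σ == s then setSign (side k s) (not s) y else flipTo (side k s) (setSign (side k s) s y)
move k blocks     σ y =
  if sign (side k (not σ)) y == not σ then flipTo (side k (not σ)) y
  else if sign (side k σ) y == not σ then y
  else if above (side k σ) (side k (not σ)) y then flipTo (side k σ) y else y

ruleOf : ℕ → Word → Rule
ruleOf k []      = blocks
ruleOf k (t ∷ V) = rule k t V

rest : {A : Set} → List A → List A
rest []      = []
rest (_ ∷ V) = V

-- The last two blocks are oriented by 4 flips, and 3 more flips undo the rotation.
cost : ℕ → Word → Stack → ℕ
cost (suc (suc (suc k))) W ((v , σ) ∷ z) =
  price (suc (suc k)) r σ y + cost (suc (suc k)) (after (suc (suc k)) r (rest ρ)) (move (suc (suc k)) r σ y)
  where
  ρ = iterate rotate W v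
  y = relabel pred (iterate (shift (suc (suc k))) z v)
  r = ruleOf (suc (suc k)) ρ
cost _ _ _ = 7

-- Cyclic words, their rotations and their potential.

module _ {A : Set} where

  length-rotate : (xs : List A) → length (rotate xs) ≡ length xs
  length-rotate []       = refl
  length-rotate (x ∷ xs) = trans (length-++ xs) (+-comm (length xs) 1)

  length-update : ∀ j f (xs : List A) → length (update j f xs) ≡ length xs
  length-update j       f []       = refl
  length-update zero    f (x ∷ xs) = refl
  length-update (suc j) f (x ∷ xs) = cong suc (length-update j f xs)

  length-iterate-rotate : ∀ i (xs : List A) → length (iterate rotate xs i) ≡ length xs
  length-iterate-rotate zero    xs = refl
  length-iterate-rotate (suc i) xs = trans (length-iterate-rotate i (rotate xs)) (length-rotate xs)

  iterate-rotate-++ : (xs ys : List A) → iterate rotate (xs ++ ys) (length xs) ≡ ys ++ xs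
  iterate-rotate-++ []       ys = sym (++-identityʳ ys)
  iterate-rotate-++ (x ∷ xs) ys = begin
    iterate rotate ((xs ++ ys) ++ [ x ]) (length xs)  ≡⟨ cong (λ zs → iterate rotate zs (length xs)) (++-assoc xs ys [ x ]) ⟩
    iterate rotate (xs ++ ys ∷ʳ x) (length xs)        ≡⟨ iterate-rotate-++ xs (ys ∷ʳ x) ⟩
    ys ∷ʳ x ++ xs                                     ≡⟨ ++-assoc ys [ x ] xs ⟩
    ys ++ x ∷ xs                                      ∎
    where open ≡-Reasoning

  iterate-rotate-length : (xs : List A) → iterate rotate xs (length xs) ≡ xs
  iterate-rotate-length xs = trans (cong (λ zs → iterate rotate zs (length xs)) (sym (++-identityʳ xs))) (iterate-rotate-++ xs [])

  nth-++ˡ : ∀ d (xs ys : List A) {j} → j < length xs → nth d (xs ++ ys) j ≡ nth d xs j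
  nth-++ˡ d (x ∷ xs) ys {zero}  lt      = refl
  nth-++ˡ d (x ∷ xs) ys {suc j} (s≤s lt) = nth-++ˡ d xs ys lt

  nth-∷ʳ : ∀ d (xs : List A) x → nth d (xs ∷ʳ x) (length xs) ≡ x
  nth-∷ʳ d []       x = refl
  nth-∷ʳ d (y ∷ xs) x = nth-∷ʳ d xs x

  nth-rotate : ∀ d {k j} (xs : List A) → length xs ≡ suc k → j ≤ k → nth d (rotate xs) (dec k j) ≡ nth d xs j
  nth-rotate d {j = zero}  (x ∷ xs) refl le = nth-∷ʳ d xs x
  nth-rotate d {j = suc j} (x ∷ xs) refl le = nth-++ˡ d xs [ x ] le

  nth-update : ∀ d j f (xs : List A) → j < length xs → nth d (update j f xs) j ≡ f (nth d xs j)
  nth-update d zero    f (x ∷ xs) lt      = refl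
  nth-update d (suc j) f (x ∷ xs) (s≤s lt) = nth-update d j f xs lt

  nth-update-≢ : ∀ d {i j} f (xs : List A) → i ≢ j → nth d (update j f xs) i ≡ nth d xs i
  nth-update-≢ d                 f []       i≢j = refl
  nth-update-≢ d {zero}  {zero}  f (x ∷ xs) i≢j = contradiction refl i≢j
  nth-update-≢ d {zero}  {suc j} f (x ∷ xs) i≢j = refl
  nth-update-≢ d {suc i} {zero}  f (x ∷ xs) i≢j = refl
  nth-update-≢ d {suc i} {suc j} f (x ∷ xs) i≢j = nth-update-≢ d f xs (i≢j ∘ cong suc)

  update-∷ʳ : ∀ f (xs : List A) x → update (length xs) f (xs ∷ʳ x) ≡ xs ∷ʳ f x
  update-∷ʳ f []       x = refl
  update-∷ʳ f (y ∷ xs) x = cong (y ∷_) (update-∷ʳ f xs x)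

iterate-relabel-∘ : ∀ f i z → iterate (relabel f) z i ≡ relabel (λ j → iterate f j i) z
iterate-relabel-∘ f zero    z = sym (relabel-id id z (λ _ → refl))
iterate-relabel-∘ f (suc i) z = trans (iterate-relabel-∘ f i (relabel f z)) (relabel-∘ _ f z)

iterate-+ : {A : Set} (f : A → A) → ∀ i j x → iterate f x (i + j) ≡ iterate f (iterate f x i) j
iterate-+ f zero    j x = refl
iterate-+ f (suc i) j x = iterate-+ f i j (f x)

iterate-dec-down : ∀ k i j → iterate (dec k) (i + j) i ≡ j
iterate-dec-down k zero    j = refl
iterate-dec-down k (suc i) j = iterate-dec-down k i j

-- `j` steps lead down to `0`, one more wraps round to `k`, and the remaining `k ∸ j` lead down to
-- `j`.
iterate-dec-full : ∀ {k j} → j ≤ k → iterate (dec k) j (suc k) ≡ j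
iterate-dec-full {k} {j} j≤k = begin
  iterate (dec k) j (suc k)                      ≡⟨ cong (λ i → iterate (dec k) j (suc i)) (m+[n∸m]≡n j≤k) ⟨
  iterate (dec k) j (suc (j + (k ∸ j)))          ≡⟨ cong (iterate (dec k) j) (+-suc j (k ∸ j)) ⟨
  iterate (dec k) j (j + suc (k ∸ j))            ≡⟨ iterate-+ (dec k) j (suc (k ∸ j)) j ⟩
  iterate (dec k) (iterate (dec k) j j) (suc (k ∸ j))  ≡⟨ cong (λ h → iterate (dec k) h (suc (k ∸ j))) (iterate-dec k j) ⟩
  iterate (dec k) k (k ∸ j)                      ≡⟨ cong (λ h → iterate (dec k) h (k ∸ j)) (m∸n+n≡m j≤k) ⟨
  iterate (dec k) (k ∸ j + j) (k ∸ j)            ≡⟨ iterate-dec-down k (k ∸ j) j ⟩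
  j                                              ∎
  where open ≡-Reasoning

-- `cost` itself rotates until the top label is `0`, so for a positive top label both sides agree by
-- computation. Only top label `0`, which wraps round to the largest label, needs that a full turn
-- is the identity.
cost-rotate : ∀ k W x → length W ≡ suc k → Valid (suc k) x → cost (suc k) (rotate W) (shift k x) ≡ cost (suc k) W x
cost-rotate zero          W x eq val = refl
cost-rotate (suc zero)    W x eq val = refl
cost-rotate (suc (suc k)) W []                  eq val = refl
cost-rotate (suc (suc k)) W ((suc v , σ) ∷ z) eq val = refl
cost-rotate (suc (suc k)) W ((zero , σ) ∷ z)  eq val =
  cong₂ (λ ρ y → price K (ruleOf K ρ) σ y + cost K (after K (ruleOf K ρ) (rest ρ)) (move K (ruleOf K ρ) σ y))
    (trans (cong (iterate rotate W) (sym eq)) (iterate-rotate-length W))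
    (cong (relabel pred) (trans (iterate-relabel-∘ (dec K) (suc K) z)
      (relabel-id _ z (λ i → iterate-dec-full (≤-pred (valid-< {x = (0 , σ) ∷ z} val (there i)))))))
  where K = suc (suc k)

-- A single pancake is worth 36 and a block 39, less 4 for every single wanting right followed by a single wanting left.
-- To avoid the subtraction, 4 is moved from the letters to the links; 11 keeps the bound true for words that never occur.
weight : Type → ℕ
weight (one _) = 32
weight blk     = 35

link : Type → Type → ℕ
link (one true)  (one false) = 0
link (one true)  (one true)  = 11
link (one false) (one false) = 11
link _           _           = 4

walk : Type → Word → ℕ
walk t []      = 0
walk t (w ∷ V) = weight t + link t w + walk w V

end : Type → Word → Type
end t []      = t
end t (w ∷ V) = end w V

-- In units of 1/24 of a flip: the expected remaining cost is at most the potential, plus a constant.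
potential : Word → ℕ
potential []      = 0
potential (t ∷ V) = walk t V + (weight (end t V) + link (end t V) t)

walk-++ : ∀ t V w → walk t (V ∷ʳ w) ≡ walk t V + (weight (end t V) + link (end t V) w)
walk-++ t []      w = +-identityʳ _
walk-++ t (x ∷ V) w = trans (cong (weight t + link t x +_) (walk-++ x V w)) (sym (+-assoc (weight t + link t x) _ _))

end-∷ʳ : ∀ t V w → end t (V ∷ʳ w) ≡ w
end-∷ʳ t []      w = refl
end-∷ʳ t (x ∷ V) w = end-∷ʳ x V w

end-nth : ∀ d t V → end t V ≡ nth d (t ∷ V) (length V)
end-nth d t []      = refl
end-nth d t (w ∷ V) = end-nth d w V

potential-rotate : ∀ W → potential (rotate W) ≡ potential W
potential-rotate []          = refl
potential-rotate (t ∷ [])    = refl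
potential-rotate (t ∷ w ∷ V) = begin
  walk w (V ∷ʳ t) + (weight (end w (V ∷ʳ t)) + link (end w (V ∷ʳ t)) w)
    ≡⟨ cong₂ _+_ (walk-++ w V t) (cong (λ e → weight e + link e w) (end-∷ʳ w V t)) ⟩
  walk w V + (weight (end w V) + link (end w V) t) + (weight t + link t w)
    ≡⟨ +-comm _ (weight t + link t w) ⟩
  weight t + link t w + (walk w V + (weight (end w V) + link (end w V) t))
    ≡⟨ +-assoc (weight t + link t w) _ _ ⟨
  weight t + link t w + walk w V + (weight (end w V) + link (end w V) t)
    ∎
  where open ≡-Reasoning

-- The part of the potential of … l a b c … that joining a and b can change.
local : Type → Type → Type → Type → ℕ
local l a b c = weight a + link a b + (weight b + link b c) + link l a

-- 43 = 35 + 4 + 4 is a block with its two links, which are 4 whatever its neighbours are. `δ` is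
-- the expected price of the join and `ε` the overspending allowed.
potential-join : ∀ a b c Z δ ε → 43 + δ ≤ local (end c Z) a b c + ε →
                 potential (blk ∷ c ∷ Z) + δ ≤ potential (a ∷ b ∷ c ∷ Z) + ε
potential-join a b c Z δ ε le = begin
  (weight blk + 4 + walk c Z) + (weight l + link l blk) + δ  ≡⟨ cong (λ e → (39 + walk c Z) + (weight l + e) + δ) (link-blk l) ⟩
  (39 + walk c Z) + (weight l + 4) + δ                       ≡⟨ rearrange (walk c Z) (weight l) δ ⟩
  (43 + δ) + (walk c Z + weight l)                           ≤⟨ +-monoˡ-≤ _ le ⟩
  (local l a b c + ε) + (walk c Z + weight l)                ≡⟨ rearrange′ (weight a + link a b) (weight b + link b c) (walk c Z) (weight l) (link l a) ε ⟩
  (weight a + link a b + (weight b + link b c + walk c Z)) + (weight l + link l a) + ε  ∎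
  where
  open ≤-Reasoning
  l = end c Z
  link-blk : ∀ t → link t blk ≡ 4
  link-blk (one true)  = refl
  link-blk (one false) = refl
  link-blk blk         = refl
  rearrange : ∀ x y z → (39 + x) + (y + 4) + z ≡ (43 + z) + (x + y)
  rearrange = solve-∀
  rearrange′ : ∀ p q x y z e → (p + q + z + e) + (x + y) ≡ (p + (q + x)) + (y + z) + e
  rearrange′ = solve-∀

data Ends : Word → Set where
  ends : ∀ c Z u → Ends (c ∷ Z ∷ʳ u)

toEnds : ∀ {k} V → length V ≡ suc (suc k) → Ends V
toEnds (c ∷ V) eq with initLast V
... | Z ∷ʳ′ u = ends c Z u

-- Turns a statement about all letters into a Boolean that evaluates, so that the numerical bounds
-- below are proved by `_`.
forall-type : (p : Type → Bool) → T (p (one true) ∧ p (one false) ∧ p blk) → ∀ t → T (p t)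
forall-type p h with p (one true) in e₁ | p (one false) in e₂ | p blk in e₃
... | true | true | true = λ { (one true) → subst T (sym e₁) _ ; (one false) → subst T (sym e₂) _ ; blk → subst T (sym e₃) _ }

forall-types : (p : Type → Type → Bool) → T (p (one true) (one true) ∧ p (one true) (one false) ∧ p (one true) blk) →
               T (p (one false) (one true) ∧ p (one false) (one false) ∧ p (one false) blk) →
               T (p blk (one true) ∧ p blk (one false) ∧ p blk blk) → ∀ t u → T (p t u)
forall-types p h₁ h₂ h₃ (one true)  = forall-type (p (one true)) h₁
forall-types p h₁ h₂ h₃ (one false) = forall-type (p (one false)) h₂
forall-types p h₁ h₂ h₃ blk         = forall-type (p blk) h₃

-- Expected cost

not-== : ∀ t s → (not t == s) ≡ not (t == s)
not-== true  s = refl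
not-== false s = sym (not-involutive s)

2* : ∀ n → n + n ≡ 2 * n
2* n = cong (n +_) (sym (+-identityʳ n))

side-< : ∀ {k} → 2 ≤ k → ∀ s → side k s < k
side-< (s≤s _) true  = s≤s z≤n
side-< (s≤s _) false = ≤-refl

side-≢ : ∀ {k} → 2 ≤ k → ∀ s → side k s ≢ side k (not s)
side-≢ (s≤s (s≤s _)) true  ()
side-≢ (s≤s (s≤s _)) false ()

module _ (k : ℕ) where

  private
    S : (Stack → ℕ) → ℕ
    S = ∑ (stacks k)

  ∑-fold : (φ : Stack → Stack) → (∀ {x} → Valid k x → Valid k (φ x)) → (∀ {x} → Valid k x → φ (φ x) ≡ x) →
           (f : Stack → ℕ) → S (λ x → f x + f (φ x)) ≡ 2 * S f
  ∑-fold φ v i f = begin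
    S (λ x → f x + f (φ x))  ≡⟨ ∑-+ (stacks k) f (f ∘ φ) ⟩
    S f + S (f ∘ φ)          ≡⟨ cong (S f +_) (∑-stacks-involution k φ v i f) ⟩
    S f + S f                ≡⟨ 2* (S f) ⟩
    2 * S f                  ∎
    where open ≡-Reasoning

  toggle-valid : ∀ {a x} → Valid k x → Valid k (toggle a x)
  toggle-valid {a} {x} = resign-valid _ {x}

  module _ {a : ℕ} (a<k : a < k) where

    at : ∀ {x} → Valid k x → Split a x
    at {x} v = valid-split {x = x} v a<k

    ∑-toggle : (f : Stack → ℕ) → S (λ x → f x + f (toggle a x)) ≡ 2 * S f
    ∑-toggle = ∑-fold (toggle a) (λ {x} → toggle-valid {x = x}) (λ v → toggle-involutive (at v))

    ∑-flipTo : (f : Stack → ℕ) → S (f ∘ flipTo a) ≡ S f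
    ∑-flipTo = ∑-stacks-involution k (flipTo a) (λ {x} → flipTo-valid {x = x} a<k) (λ v → flipTo-involutive (at v))

    ∑-setSign : (f : Stack → ℕ) → S (f ∘ setSign a true) + S (f ∘ setSign a false) ≡ 2 * S f
    ∑-setSign f = begin
      S (f ∘ setSign a true) + S (f ∘ setSign a false)          ≡⟨ ∑-+ (stacks k) (f ∘ setSign a true) (f ∘ setSign a false) ⟨
      S (λ x → f (setSign a true x) + f (setSign a false x))    ≡⟨ ∑-stacks-cong k (λ v → setSign-pair f (at v)) ⟩
      S (λ x → f x + f (toggle a x))                            ≡⟨ ∑-toggle f ⟩
      2 * S f                                                   ∎
      where open ≡-Reasoning

    ∑-flipTo-setSign : ∀ b (f : Stack → ℕ) → S (λ x → f (flipTo a (setSign a b x))) ≡ S (f ∘ setSign a b)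
    ∑-flipTo-setSign b f = trans (∑-stacks-cong k (λ v → cong f (flipTo-setSign b (at v)))) (∑-flipTo (f ∘ setSign a b))

    ∑-sign : ∀ b c d → 2 * S (λ x → if sign a x == b then c else d) ≡ count k * (c + d)
    ∑-sign b c d = trans (sym (∑-toggle _)) (trans (∑-stacks-cong k pointwise) (∑-stacks-const k (c + d)))
      where
      pointwise : ∀ {x} → Valid k x →
        (if sign a x == b then c else d) + (if sign a (toggle a x) == b then c else d) ≡ c + d
      pointwise {x} v rewrite sign-toggle (at v) | not-== (sign a x) b with sign a x == b
      ... | true  = refl
      ... | false = +-comm d c

  rule-total : Rule → (Stack → ℕ) → ℕ
  rule-total r g = S (λ y → price k r true y + g (move k r true y)) + S (λ y → price k r false y + g (move k r false y))

  total-split : ∀ r σ g → S (λ y → price k r σ y + g (move k r σ y)) ≡ S (price k r σ) + S (g ∘ move k r σ)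
  total-split r σ g = ∑-+ (stacks k) (price k r σ) (g ∘ move k r σ)

  module _ (2≤k : 2 ≤ k) where

    side< : ∀ s → side k s < k
    side< = side-< 2≤k

    side≢ : ∀ s → side k s ≢ side k (not s)
    side≢ = side-≢ 2≤k

    move-valid : ∀ r σ {x} → Valid k x → Valid k (move k r σ x)
    move-valid (pair s) σ {x} v = flipTo-valid {x = setSign (side k s) s x} (side< s) (resign-valid _ {x} v)
    move-valid (single s) σ {x} v with sign (side k s) x == s
    ... | true  = flipTo-valid {x = x} (side< s) v
    ... | false = v
    move-valid (extend s) σ {x} v with σ == s
    ... | true  = resign-valid _ {x} v
    ... | false = flipTo-valid {x = setSign (side k s) s x} (side< s) (resign-valid _ {x} v)
    move-valid blocks σ {x} v with sign (side k (not σ)) x == not σ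
    ... | true = flipTo-valid {x = x} (side< (not σ)) v
    ... | false with sign (side k σ) x == not σ
    ...   | true = v
    ...   | false with above (side k σ) (side k (not σ)) x
    ...     | true  = flipTo-valid {x = x} (side< σ) v
    ...     | false = v

    -- The new block gets sign `s` whatever the stack is, so `S g` does not appear on the right;
    -- `pair-bound` supplies the other sign.
    pair-total : ∀ s g → rule-total (pair s) g ≡ 2 * count k + 2 * S (g ∘ setSign (side k s) s)
    pair-total s g = begin
      H + H                                   ≡⟨ cong₂ _+_ H≡ H≡ ⟩
      (count k * 1 + R) + (count k * 1 + R)   ≡⟨ rearrange (count k) R ⟩
      2 * count k + 2 * R                     ∎
      where
      open ≡-Reasoning
      a = side k s
      R = S (g ∘ setSign a s)
      H = S (λ y → 1 + g (flipTo a (setSign a s y)))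
      H≡ : H ≡ count k * 1 + R
      H≡ = trans (∑-+ (stacks k) (λ _ → 1) _) (cong₂ _+_ (∑-stacks-const k 1) (∑-flipTo-setSign (side< s) s g))
      rearrange : ∀ n r → (n * 1 + r) + (n * 1 + r) ≡ 2 * n + 2 * r
      rearrange = solve-∀

    -- The move ignores the top sign and is an involution of the rest, since `flipTo` preserves the
    -- sign that is tested. The price is 1 or 2 according to the random sign of the neighbour.
    single-total : ∀ s g → rule-total (single s) g ≡ 3 * count k + 2 * S g
    single-total s g = begin
      H + H                                       ≡⟨ cong₂ _+_ H≡ H≡ ⟩
      (Q + S g) + (Q + S g)                       ≡⟨ rearrange Q (S g) ⟩
      2 * Q + 2 * S g                             ≡⟨ cong (_+ 2 * S g) (trans (∑-sign (side< s) s 1 2) (*-comm (count k) 3)) ⟩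
      3 * count k + 2 * S g                       ∎
      where
      open ≡-Reasoning
      a = side k s
      φ = move k (single s) true
      Q = S (price k (single s) true)
      H = S (λ y → price k (single s) true y + g (φ y))
      inv : ∀ {x} → Valid k x → φ (φ x) ≡ x
      inv {x} v with sign a x == s in eq
      ... | true rewrite sign-flipTo (at (side< s) {x} v) | eq = flipTo-involutive (at (side< s) {x} v)
      ... | false rewrite eq = refl
      H≡ : H ≡ Q + S g
      H≡ = trans (total-split (single s) true g) (cong (Q +_) (∑-stacks-involution k φ (move-valid (single s) true) (λ {x} → inv {x}) g))
      rearrange : ∀ q t → (q + t) + (q + t) ≡ 2 * q + 2 * t
      rearrange = solve-∀

    -- The sign of the single neighbour is overwritten, and the random sign of the top block decides
    -- the new one. Hence both signs of the enlarged block occur equally often.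
    extend-total : ∀ s g → rule-total (extend s) g ≡ 3 * count k + 2 * S g
    extend-total s g = begin
      rule-total (extend s) g                              ≡⟨ order s ⟩
      (count k * 2 + R (not s)) + (count k * 1 + R s)      ≡⟨ rearrange (count k) (R (not s)) (R s) ⟩
      3 * count k + (R (not s) + R s)                      ≡⟨ cong (3 * count k +_) (both s) ⟩
      3 * count k + (R true + R false)                     ≡⟨ cong (3 * count k +_) (∑-setSign (side< s) g) ⟩
      3 * count k + 2 * S g                                ∎
      where
      open ≡-Reasoning
      a = side k s
      R : Bool → ℕ
      R b = S (g ∘ setSign a b)
      slow : ∀ b → S (λ y → 2 + g (setSign a b y)) ≡ count k * 2 + R b
      slow b = trans (∑-+ (stacks k) (λ _ → 2) _) (cong (_+ R b) (∑-stacks-const k 2))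
      fast : ∀ b → S (λ y → 1 + g (flipTo a (setSign a b y))) ≡ count k * 1 + R b
      fast b = trans (∑-+ (stacks k) (λ _ → 1) _) (cong₂ _+_ (∑-stacks-const k 1) (∑-flipTo-setSign (side< s) b g))
      order : ∀ s′ → (S (λ y → price k (extend s′) true y + g (if true == s′ then setSign a (not s) y else flipTo a (setSign a s y))) +
                      S (λ y → price k (extend s′) false y + g (if false == s′ then setSign a (not s) y else flipTo a (setSign a s y))))
                     ≡ (count k * 2 + R (not s)) + (count k * 1 + R s)
      order true  = cong₂ _+_ (slow (not s)) (fast s)
      order false = trans (cong₂ _+_ (fast s) (slow (not s))) (+-comm (count k * 1 + R s) _)
      both : ∀ s′ → R (not s′) + R s′ ≡ R true + R false
      both true  = +-comm (R false) (R true)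
      both false = refl
      rearrange : ∀ n p q → (n * 2 + p) + (n * 1 + q) ≡ 3 * n + (p + q)
      rearrange = solve-∀

    -- 13/8 flips on average: 1 with probability 1/2, 2 with probability 3/8 and 3 with probability 1/8.
    blocks-price : ∀ σ → 8 * S (price k blocks σ) ≡ 13 * count k
    blocks-price σ = begin
      8 * S p₀                               ≡⟨ *-assoc 4 2 (S p₀) ⟩
      4 * (2 * S p₀)                         ≡⟨ cong (4 *_) (∑-fold reverse (λ {x} → reverse-valid {x = x}) (λ {x} _ → reverse-involutive x) p₀) ⟨
      4 * S (λ y → p₀ y + p₀ (reverse y))    ≡⟨ cong (4 *_) (∑-stacks-cong k (λ {x} → by-order {x})) ⟩
      4 * S p₁                               ≡⟨ *-assoc 2 2 (S p₁) ⟩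
      2 * (2 * S p₁)                         ≡⟨ cong (2 *_) (∑-toggle (side< σ) p₁) ⟨
      2 * S (λ y → p₁ y + p₁ (toggle b y))   ≡⟨ cong (2 *_) (∑-stacks-cong k (λ {x} → by-sign {x})) ⟩
      2 * S p₂                               ≡⟨ ∑-sign (side< (not σ)) (not σ) 4 9 ⟩
      count k * 13                           ≡⟨ *-comm (count k) 13 ⟩
      13 * count k                           ∎
      where
      open ≡-Reasoning
      a = side k (not σ)
      b = side k σ
      a≢b : a ≢ b
      a≢b = side≢ σ ∘ sym
      -- Reversing the list without turning blocks keeps the signs and swaps the order of `a` and
      -- `b`, which averages the test `above`: `p₁` has the values 1 + 1, 2 + 2 and 2 + 3. Toggling
      -- `b` then gives 2 + 2 and 4 + 5 in `p₂`, and toggling `a` gives 13.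
      p₀ p₁ p₂ : Stack → ℕ
      p₀ = price k blocks σ
      p₁ y = if sign a y == not σ then 2 else if sign b y == not σ then 4 else 5
      p₂ y = if sign a y == not σ then 4 else 9
      by-order : ∀ {x} → Valid k x → p₀ x + p₀ (reverse x) ≡ p₁ x
      by-order {x} v
        rewrite sign-reverse (at (side< (not σ)) {x} v) | sign-reverse (at (side< σ) {x} v)
              | above-reverse {x = x} a≢b (valid-order a≢b (side< (not σ)) (side< σ) v)
        with sign a x == not σ | sign b x == not σ | above b a x
      ... | true  | _     | _     = refl
      ... | false | true  | _     = refl
      ... | false | false | true  = refl
      ... | false | false | false = refl
      by-sign : ∀ {x} → Valid k x → p₁ x + p₁ (toggle b x) ≡ p₂ x
      by-sign {x} v
        rewrite sign-toggle-≢ {b} {a} x (a≢b ∘ sym) | sign-toggle (at (side< σ) {x} v) | not-== (sign b x) (not σ)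
        with sign a x == not σ | sign b x == not σ
      ... | true  | _     = refl
      ... | false | true  = refl
      ... | false | false = refl

    -- Every branch maps the stacks that pass its tests to stacks that pass them again, so `φ` is an
    -- involution branch by branch. For the branch that flips onto `b` this is `above-flipTo`.
    blocks-move : ∀ σ g → S (g ∘ move k blocks σ) ≡ S g
    blocks-move σ = ∑-stacks-involution k φ (move-valid blocks σ) (λ {x} → inv {x})
      where
      a = side k (not σ)
      b = side k σ
      a≢b : a ≢ b
      a≢b = side≢ σ ∘ sym
      φ = move k blocks σ
      inv : ∀ {x} → Valid k x → φ (φ x) ≡ x
      inv {x} v with sign a x == not σ in e₁
      ... | true rewrite sign-flipTo (at (side< (not σ)) {x} v) | e₁ = flipTo-involutive (at (side< (not σ)) {x} v)
      ... | false with sign b x == not σ in e₂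
      ...   | true rewrite e₁ | e₂ = refl
      ...   | false with above b a x in e₃
      ...     | false rewrite e₁ | e₂ | e₃ = refl
      ...     | true with above-flipTo a≢b (valid-order {x = x} a≢b (side< (not σ)) (side< σ) v) e₃
      ...       | s≡ , o≡ rewrite s≡ | e₁ | sign-flipTo (at (side< σ) {x} v) | e₂ | o≡ = flipTo-involutive (at (side< σ) {x} v)

    blocks-total : ∀ g → 4 * rule-total blocks g ≡ 13 * count k + 8 * S g
    blocks-total g = begin
      4 * rule-total blocks g                               ≡⟨ cong (4 *_) (cong₂ _+_ (half true) (half false)) ⟩
      4 * ((P true + S g) + (P false + S g))                ≡⟨ *-cancelˡ-≡ _ _ 2 (trans (rearrange (P true) (P false) (S g))
                                                                (trans (cong₂ (λ p q → p + q + 16 * S g) (blocks-price true) (blocks-price false)) (rearrange′ (count k) (S g)))) ⟩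
      13 * count k + 8 * S g                                ∎
      where
      open ≡-Reasoning
      P : Bool → ℕ
      P σ = S (price k blocks σ)
      half : ∀ σ → S (λ y → price k blocks σ y + g (move k blocks σ y)) ≡ P σ + S g
      half σ = trans (total-split blocks σ g) (cong (P σ +_) (blocks-move σ g))
      rearrange : ∀ p q t → 2 * (4 * ((p + t) + (q + t))) ≡ 8 * p + 8 * q + 16 * t
      rearrange = solve-∀
      rearrange′ : ∀ n t → 13 * n + 13 * n + 16 * t ≡ 2 * (13 * n + 8 * t)
      rearrange′ = solve-∀

-- Pairs in a cyclic word and the local drop of the potential.

bit : Bool → ℕ
bit b = if b then 1 else 0

isL isR : Type → Bool
isL (one false) = true
isL _           = false
isR (one true)  = true
isR _           = false

-- Meant for cyclically consecutive positions, `i` before `j`. `isL` comes first so that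
-- `pairAt k 0` computes to `false` on a word that starts with a block or a right-wanting single.
pairAt : ℕ → ℕ → Word → Bool
pairAt i j ρ = isL (nth blk ρ j) ∧ isR (nth blk ρ i)

pairAt-rotate : ∀ {k i j} ρ → length ρ ≡ suc k → i ≤ k → j ≤ k → pairAt (dec k i) (dec k j) (rotate ρ) ≡ pairAt i j ρ
pairAt-rotate ρ eq i≤k j≤k = cong₂ (λ t u → isL t ∧ isR u) (nth-rotate blk ρ eq j≤k) (nth-rotate blk ρ eq i≤k)

≤ᵇ-types : (f : Type → Type → ℕ) (c : ℕ) → _ → _ → _ → ∀ t u → c ≤ f t u
≤ᵇ-types f c h₁ h₂ h₃ t u = ≤ᵇ⇒≤ c (f t u) (forall-types (λ t u → c ≤ᵇ f t u) h₁ h₂ h₃ t u)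

-- 72 = 43 + 29, more than the price 24 of one flip.
local-pair : ∀ l c → 72 ≤ local l (one true) (one false) c + 0
local-pair = ≤ᵇ-types (λ l c → local l (one true) (one false) c + 0) 72 _ _ _

-- 79 = 43 + 36, the price of 3/2 flips. Two singles that both want right can attain it, as in 32 +
-- 11 + 32 + 0 + 4, and this is what requires the link 11.
local-right : ∀ l w c → isL w ≡ false → 79 ≤ local l (one true) w c + 0
local-right l (one true) c e = ≤ᵇ-types (λ l c → local l (one true) (one true) c + 0) 79 _ _ _ l c
local-right l blk        c e = ≤ᵇ-types (λ l c → local l (one true) blk c + 0) 79 _ _ _ l c

local-left : ∀ l u c → isR u ≡ false → 79 ≤ local l u (one false) c + 0
local-left l (one false) c e = ≤ᵇ-types (λ l c → local l (one false) (one false) c + 0) 79 _ _ _ l c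
local-left l blk         c e = ≤ᵇ-types (λ l c → local l blk (one false) c + 0) 79 _ _ _ l c

-- If the single is the right-wanting half of a pair, its outer link is 0 where any other would be
-- at least 4; that is the whole shortfall.
local-blk-right : ∀ l r c → 79 ≤ local l blk (one r) c + 4 * bit (isL c ∧ isR (one r))
local-blk-right l true  c = ≤ᵇ-types (λ l c → local l blk (one true) c + 4 * bit (isL c ∧ true)) 79 _ _ _ l c
local-blk-right l false c = ≤ᵇ-types (λ l c → local l blk (one false) c + 4 * bit (isL c ∧ false)) 79 _ _ _ l c

local-blk-left : ∀ l r c → 79 ≤ local l (one r) blk c + 4 * bit (isL (one r) ∧ isR l)
local-blk-left l true  c = ≤ᵇ-types (λ l c → local l (one true) blk c + 4 * bit (false ∧ isR l)) 79 _ _ _ l c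
local-blk-left l false c = ≤ᵇ-types (λ l c → local l (one false) blk c + 4 * bit (true ∧ isR l)) 79 _ _ _ l c

oneRule-right : ∀ w → isL w ≡ false → oneRule true w ≡ single true
oneRule-right (one true) e = refl
oneRule-right blk        e = refl

oneRule-left : ∀ u → isR u ≡ false → oneRule false u ≡ single false
oneRule-left (one false) e = refl
oneRule-left blk         e = refl

-- Label `0` becomes `k`, and by validity no other label does.
setSign-shift : ∀ k b x → Valid (suc k) x → setSign k b (shift k x) ≡ shift k (setSign 0 b x)
setSign-shift k b x v = trans (sym (map-∘ x)) (trans (map-cong-local (All.tabulate pointwise)) (map-∘ x))
  where
  pointwise : ∀ {p} → p ∈ x → (dec k (proj₁ p) , (if dec k (proj₁ p) ≡ᵇ k then b else proj₂ p)) ≡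
                               (dec k (proj₁ p) , (if proj₁ p ≡ᵇ 0 then b else proj₂ p))
  pointwise {zero , σ}  i rewrite ≡ᵇ-refl k = refl
  pointwise {suc j , σ} i rewrite ≡ᵇ-≢ (<⇒≢ (≤-pred (valid-< {x = x} v (∈-map⁺ proj₁ i)))) = refl

∑-upTo-suc : ∀ m (g : ℕ → ℕ) → g m ≡ g 0 → ∑ (upTo m) (g ∘ suc) ≡ ∑ (upTo m) g
∑-upTo-suc m g eq = +-cancelˡ-≡ (g 0) _ _ (begin
  g 0 + ∑ (upTo m) (g ∘ suc)         ≡⟨ cong (g 0 +_) (∑-map suc (upTo m) g) ⟨
  ∑ (0 ∷ map suc (upTo m)) g         ≡⟨ cong (λ is → ∑ is g) (trans (sym (upTo-suc m)) (sym (upTo-∷ʳ m))) ⟩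
  ∑ (upTo m ∷ʳ m) g                  ≡⟨ ∑-++ (upTo m) [ m ] g ⟩
  ∑ (upTo m) g + (g m + 0)           ≡⟨ cong (∑ (upTo m) g +_) (trans (+-identityʳ _) eq) ⟩
  ∑ (upTo m) g + g 0                 ≡⟨ +-comm _ (g 0) ⟩
  g 0 + ∑ (upTo m) g                 ∎)
  where open ≡-Reasoning

∑-rotations : ∀ {A : Set} m (W : List A) (f : List A → ℕ) → length W ≡ m →
              ∑ (upTo m) (λ i → f (rotate (iterate rotate W i))) ≡ ∑ (upTo m) (λ i → f (iterate rotate W i))
∑-rotations m W f refl = trans (∑-cong (upTo m) (λ i → cong f (sym (iterate-comm rotate i W))))
  (∑-upTo-suc m (λ i → f (iterate rotate W i)) (cong f (iterate-rotate-length W)))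

-- `p`, `q`, `p′` and `q′` all count the pairs of the cyclic word when summed over its rotations. So
-- the saving 8 cancels against 4 + 4 and the moved potential `P` against itself; debts and credits
-- stand on opposite sides to avoid subtraction.
∑-balance : {A : Set} (I : List A) (H G p q p′ q′ : A → ℕ) (N P : ℕ) →
  ∑ I q ≡ ∑ I p → ∑ I p′ ≡ ∑ I p → ∑ I q′ ≡ ∑ I p →
  (∀ i → 24 * (H i + G i) + 2 * N * (8 * p i + P * q i) ≤ 2 * N * (P + (4 * p′ i + 4 * q′ i) + P * p i)) →
  24 * (∑ I H + ∑ I G) ≤ 2 * N * (length I * P)
∑-balance I H G p q p′ q′ N P Σq Σp′ Σq′ le = +-cancelʳ-≤ X _ _ (begin
  24 * (∑ I H + ∑ I G) + X
    ≡⟨ cong₂ _+_ (trans (∑-* 24 I _) (cong (24 *_) (∑-+ I H G)))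
         (trans (linear p q 8 P) (cong (λ s → 2 * N * (8 * Π + P * s)) Σq)) ⟨
  ∑ I (λ i → 24 * (H i + G i)) + ∑ I (λ i → 2 * N * (8 * p i + P * q i))
    ≡⟨ ∑-+ I _ _ ⟨
  ∑ I (λ i → 24 * (H i + G i) + 2 * N * (8 * p i + P * q i))
    ≤⟨ ∑-mono-∈ I (λ {i} _ → le i) ⟩
  ∑ I (λ i → 2 * N * (P + (4 * p′ i + 4 * q′ i) + P * p i))
    ≡⟨ trans (∑-* (2 * N) I _) (cong (2 * N *_) (trans (∑-+ I _ _) (cong₂ _+_
         (trans (∑-+ I _ _) (cong₂ _+_ (∑-const P I)
           (trans (∑-+ I _ _) (cong₂ _+_ (trans (∑-* 4 I p′) (cong (4 *_) Σp′)) (trans (∑-* 4 I q′) (cong (4 *_) Σq′))))))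
         (∑-* P I p)))) ⟩
  2 * N * (length I * P + (4 * Π + 4 * Π) + P * Π)
    ≡⟨ rearrange N (length I) P Π ⟩
  2 * N * (length I * P) + X ∎)
  where
  open ≤-Reasoning
  Π = ∑ I p
  X = 2 * N * (8 * Π + P * Π)
  linear : ∀ f g d e → ∑ I (λ i → 2 * N * (d * f i + e * g i)) ≡ 2 * N * (d * ∑ I f + e * ∑ I g)
  linear f g d e = trans (∑-* (2 * N) I _) (cong (2 * N *_) (trans (∑-+ I _ _) (cong₂ _+_ (∑-* d I f) (∑-* e I g))))
  rearrange : ∀ n m p π → 2 * n * (m * p + (4 * π + 4 * π) + p * π) ≡ 2 * n * (m * p) + 2 * n * (8 * π + p * π)
  rearrange = solve-∀

potential-iterate : ∀ i W → potential (iterate rotate W i) ≡ potential W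
potential-iterate zero    W = refl
potential-iterate (suc i) W = trans (potential-iterate i (rotate W)) (potential-rotate W)

-- The induction step: one block less.

module _ (k′ : ℕ) where

  private
    k = suc (suc k′)
    N = count k

  tot : Word → ℕ
  tot V = ∑ (stacks k) (cost k V)

  -- The total over the `2 * N` signed arrangements with the first letter of `ρ` on top, which is
  -- why the bounds below carry the factor `2 * N`.
  root : Word → ℕ
  root ρ = rule-total k (ruleOf k ρ) (cost k (after k (ruleOf k ρ) (rest ρ)))

  ∑-cost : ∀ W → ∑ (stacks (suc k)) (cost (suc k) W) ≡ ∑ (upTo (suc k)) (λ i → root (iterate rotate W i))
  ∑-cost W = trans (∑-stacks k (cost (suc k) W)) (∑-cong-∈ (upTo (suc k)) λ {i} i∈ →
    cong₂ _+_ (∑-cong (stacks k) (unroll i∈ true)) (∑-cong (stacks k) (unroll i∈ false)))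
    where
    unroll : ∀ {i} → i ∈ upTo (suc k) → ∀ σ y →
      cost (suc k) W (iterate (unshift k) ((0 , σ) ∷ relabel suc y) i) ≡
      price k (ruleOf k (iterate rotate W i)) σ y +
      cost k (after k (ruleOf k (iterate rotate W i)) (rest (iterate rotate W i))) (move k (ruleOf k (iterate rotate W i)) σ y)
    unroll {i} i∈ σ y = trans (cong (cost (suc k) W) top)
      (cong (λ z → price k (ruleOf k (iterate rotate W i)) σ z +
        cost k (after k (ruleOf k (iterate rotate W i)) (rest (iterate rotate W i))) (move k (ruleOf k (iterate rotate W i)) σ z)) below)
      where
      top : iterate (unshift k) ((0 , σ) ∷ relabel suc y) i ≡ (i , σ) ∷ iterate (unshift k) (relabel suc y) i
      top = trans (iterate-relabel (inc k) i 0 σ (relabel suc y))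
        (cong (λ j → (j , σ) ∷ iterate (unshift k) (relabel suc y) i)
          (trans (iterate-inc k 0 i (≤-trans (≤-reflexive (+-identityʳ i)) (≤-pred (∈-upTo⁻ i∈)))) (+-identityʳ i)))
      below : relabel pred (iterate (shift k) (iterate (unshift k) (relabel suc y) i) i) ≡ y
      below = trans (cong (relabel pred) (iterate-cancel (unshift k) (shift k) (shift-unshift k) i (relabel suc y)))
        (trans (relabel-∘ pred suc y) (relabel-id _ y (λ _ → refl)))

  module _ (bound : ∀ V → length V ≡ k → 24 * tot V ≤ N * (potential V + 168)) where

    2≤k : 2 ≤ k
    2≤k = s≤s (s≤s z≤n)

    -- Serves `single` and `extend` alike: `3 * N` flips over `2 * N` stacks are 36 units for each.
    join-bound : ∀ V P ε → length V ≡ k → potential V + 36 ≤ P + ε → 24 * (3 * N + 2 * tot V) ≤ 2 * N * (P + 168 + ε)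
    join-bound V P ε eq le = begin
      24 * (3 * N + 2 * tot V)                      ≡⟨ rearrange N (tot V) ⟩
      72 * N + 2 * (24 * tot V)                     ≤⟨ +-monoʳ-≤ (72 * N) (*-monoʳ-≤ 2 (bound V eq)) ⟩
      72 * N + 2 * (N * (potential V + 168))        ≡⟨ rearrange′ N (potential V) ⟩
      2 * N * (potential V + 36 + 168)              ≤⟨ *-monoʳ-≤ (2 * N) (+-monoˡ-≤ 168 le) ⟩
      2 * N * (P + ε + 168)                         ≡⟨ cong (2 * N *_) (swap P ε) ⟩
      2 * N * (P + 168 + ε)                         ∎
      where
      open ≤-Reasoning
      rearrange : ∀ n t → 24 * (3 * n + 2 * t) ≡ 72 * n + 2 * (24 * t)
      rearrange = solve-∀
      rearrange′ : ∀ n p → 72 * n + 2 * (n * (p + 168)) ≡ 2 * n * (p + 36 + 168)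
      rearrange′ = solve-∀
      swap : ∀ p e → p + e + 168 ≡ p + 168 + e
      swap = solve-∀

    blocks-bound : ∀ V P → length V ≡ k → potential V + 39 ≤ P → 24 * rule-total k blocks (cost k V) ≤ 2 * N * (P + 168)
    blocks-bound V P eq le = begin
      24 * rule-total k blocks (cost k V)           ≡⟨ *-assoc 6 4 (rule-total k blocks (cost k V)) ⟩
      6 * (4 * rule-total k blocks (cost k V))      ≡⟨ cong (6 *_) (blocks-total k 2≤k (cost k V)) ⟩
      6 * (13 * N + 8 * tot V)                      ≡⟨ rearrange N (tot V) ⟩
      78 * N + 2 * (24 * tot V)                     ≤⟨ +-monoʳ-≤ (78 * N) (*-monoʳ-≤ 2 (bound V eq)) ⟩
      78 * N + 2 * (N * (potential V + 168))        ≡⟨ rearrange′ N (potential V) ⟩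
      2 * N * (potential V + 39 + 168)              ≤⟨ *-monoʳ-≤ (2 * N) (+-monoˡ-≤ 168 le) ⟩
      2 * N * (P + 168)                             ∎
      where
      open ≤-Reasoning
      rearrange : ∀ n t → 6 * (13 * n + 8 * t) ≡ 78 * n + 2 * (24 * t)
      rearrange = solve-∀
      rearrange′ : ∀ n p → 78 * n + 2 * (n * (p + 168)) ≡ 2 * n * (p + 39 + 168)
      rearrange′ = solve-∀

    -- A pair gets both orientations, according to which of its two pancakes is on top.
    pair-bound : ∀ z Z → length (blk ∷ z ∷ Z) ≡ k →
      24 * (rule-total k (pair true) (cost k (blk ∷ z ∷ Z)) + rule-total k (pair false) (cost k (rotate (blk ∷ z ∷ Z)))) ≤
      4 * N * (potential (one true ∷ one false ∷ z ∷ Z) + 164)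
    pair-bound z Z eq = begin
      24 * (rule-total k (pair true) (cost k V) + rule-total k (pair false) (cost k (rotate V)))
        ≡⟨ cong (24 *_) (cong₂ _+_ (pair-total k 2≤k true (cost k V)) (pair-total k 2≤k false (cost k (rotate V)))) ⟩
      24 * ((2 * N + 2 * S true) + (2 * N + 2 * ∑ (stacks k) (cost k (rotate V) ∘ setSign (suc k′) false)))
        -- The last letter of `rotate V` is the first letter of `V`. After a shift of the labels the
        -- two terms are the two signs of one and the same block.
        ≡⟨ cong (λ t → 24 * ((2 * N + 2 * S true) + (2 * N + 2 * t))) turned ⟩
      24 * ((2 * N + 2 * S true) + (2 * N + 2 * S false))
        ≡⟨ rearrange N (S true) (S false) ⟩
      96 * N + 48 * (S true + S false)
        ≡⟨ cong (λ t → 96 * N + 48 * t) (∑-setSign k (s≤s z≤n) (cost k V)) ⟩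
      96 * N + 48 * (2 * tot V)
        ≡⟨ rearrange′ N (tot V) ⟩
      96 * N + 4 * (24 * tot V)
        ≤⟨ +-monoʳ-≤ (96 * N) (*-monoʳ-≤ 4 (bound V eq)) ⟩
      96 * N + 4 * (N * (potential V + 168))
        ≡⟨ rearrange″ N (potential V) ⟩
      4 * N * (potential V + 28 + 164)
        -- 28 = 24 + 4 pays the flip and saves 4 for each of the two top halves; the available 29 is
        -- rounded down.
        ≤⟨ *-monoʳ-≤ (4 * N) (+-monoˡ-≤ 164 (≤-trans (+-monoʳ-≤ (potential V) (n≤1+n 28)) gain)) ⟩
      4 * N * (potential (one true ∷ one false ∷ z ∷ Z) + 164)
        ∎
      where
      open ≤-Reasoning
      V = blk ∷ z ∷ Z
      S : Bool → ℕ
      S b = ∑ (stacks k) (cost k V ∘ setSign 0 b)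
      gain : potential V + 29 ≤ potential (one true ∷ one false ∷ z ∷ Z)
      gain = ≤-trans (potential-join (one true) (one false) z Z 29 0 (local-pair (end z Z) z)) (≤-reflexive (+-identityʳ (potential (one true ∷ one false ∷ z ∷ Z))))
      turned : ∑ (stacks k) (cost k (rotate V) ∘ setSign (suc k′) false) ≡ S false
      turned = trans
        (sym (∑-stacks-bijection k (shift (suc k′)) (unshift (suc k′)) (λ {x} → shift-valid {x = x}) (λ {x} → unshift-valid {x = x})
          (λ {x} → unshift-shift {x = x}) (λ {x} _ → shift-unshift (suc k′) x) (cost k (rotate V) ∘ setSign (suc k′) false)))
        (∑-stacks-cong k (λ {x} v → trans (cong (cost k (rotate V)) (setSign-shift (suc k′) false x v))
          (cost-rotate (suc k′) V (setSign 0 false x) eq (resign-valid _ {x} v))))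
      rearrange : ∀ n p q → 24 * ((2 * n + 2 * p) + (2 * n + 2 * q)) ≡ 96 * n + 48 * (p + q)
      rearrange = solve-∀
      rearrange′ : ∀ n t → 96 * n + 48 * (2 * t) ≡ 96 * n + 4 * (24 * t)
      rearrange′ = solve-∀
      rearrange″ : ∀ n p → 96 * n + 4 * (n * (p + 168)) ≡ 4 * n * (p + 28 + 164)
      rearrange″ = solve-∀

    -- What a top block may overspend by breaking the pair to its right or to its left.
    slack : Word → ℕ
    slack ρ = 4 * bit (pairAt 1 2 ρ) + 4 * bit (pairAt (suc k′) k ρ)

    right-bound : ∀ t w z Z ε → length (w ∷ z ∷ Z) ≡ k → 79 ≤ local (end z Z) t w z + ε →
      24 * (3 * N + 2 * tot (blk ∷ z ∷ Z)) ≤ 2 * N * (potential (t ∷ w ∷ z ∷ Z) + 168 + ε)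
    right-bound t w z Z ε eq le = join-bound (blk ∷ z ∷ Z) _ ε eq (potential-join t w z Z 36 ε le)

    left-bound : ∀ t c Z u ε → length (c ∷ Z ∷ʳ u) ≡ k → 79 ≤ local (end c Z) u t c + ε →
      24 * (3 * N + 2 * tot (update (suc k′) (λ _ → blk) (c ∷ Z ∷ʳ u))) ≤ 2 * N * (potential (t ∷ c ∷ Z ∷ʳ u) + 168 + ε)
    left-bound t c Z u ε eq le = join-bound _ _ ε (trans (length-update (suc k′) _ (c ∷ Z ∷ʳ u)) eq) (begin
      potential (update (suc k′) (λ _ → blk) (c ∷ Z ∷ʳ u)) + 36  ≡⟨ cong (λ j → potential (update j (λ _ → blk) (c ∷ Z ∷ʳ u)) + 36) last ⟩
      potential (update (length (c ∷ Z)) (λ _ → blk) (c ∷ Z ∷ʳ u)) + 36  ≡⟨ cong (λ V → potential V + 36) (update-∷ʳ (λ _ → blk) (c ∷ Z) u) ⟩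
      potential (rotate (blk ∷ c ∷ Z)) + 36                      ≡⟨ cong (_+ 36) (potential-rotate (blk ∷ c ∷ Z)) ⟩
      potential (blk ∷ c ∷ Z) + 36                               ≤⟨ potential-join u t c Z 36 ε le ⟩
      potential (u ∷ t ∷ c ∷ Z) + ε                              ≡⟨ cong (_+ ε) (potential-rotate (u ∷ t ∷ c ∷ Z)) ⟨
      potential (t ∷ c ∷ Z ∷ʳ u) + ε                             ∎)
      where
      open ≤-Reasoning
      last : suc k′ ≡ length (c ∷ Z)
      last = cong pred (trans (sym eq) (cong suc (trans (length-++ Z) (+-comm (length Z) 1))))

    -- The cost of a word starting with the left-wanting half of a pair is moved to the previous rotation, which starts with
    -- the other half. A pair then saves 8, which pays for the slack of both blocks that can break it.
    balanced : Word → Set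
    balanced ρ =
      24 * ((if pairAt k 0 ρ then 0 else root ρ) + (if pairAt 0 1 ρ then root (rotate ρ) else 0)) +
        2 * N * (8 * bit (pairAt 0 1 ρ) + (potential ρ + 168) * bit (pairAt k 0 ρ)) ≤
      2 * N * ((potential ρ + 168) + slack ρ + (potential ρ + 168) * bit (pairAt 0 1 ρ))

    unpaired : ∀ ρ ε → pairAt k 0 ρ ≡ false → pairAt 0 1 ρ ≡ false → ε ≤ slack ρ →
               24 * root ρ ≤ 2 * N * (potential ρ + 168 + ε) → balanced ρ
    unpaired ρ ε q p ε≤ le rewrite q | p = begin
      24 * (root ρ + 0) + 2 * N * (P * 0)      ≡⟨ rearrange (root ρ) N P ⟩
      24 * root ρ                              ≤⟨ le ⟩
      2 * N * (P + ε)                          ≤⟨ *-monoʳ-≤ (2 * N) (+-monoʳ-≤ P ε≤) ⟩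
      2 * N * (P + slack ρ)                    ≡⟨ rearrange′ N P (slack ρ) ⟩
      2 * N * (P + slack ρ + P * 0)            ∎
      where
      open ≤-Reasoning
      P = potential ρ + 168
      rearrange : ∀ r n p → 24 * (r + 0) + 2 * n * (p * 0) ≡ 24 * r
      rearrange = solve-∀
      rearrange′ : ∀ n p s → 2 * n * (p + s) ≡ 2 * n * (p + s + p * 0)
      rearrange′ = solve-∀

    module _ (c : Type) (Z : Word) (u : Type) (eq : length (c ∷ Z ∷ʳ u) ≡ k) where

      length-init : length (c ∷ Z) ≡ suc k′
      length-init = sym (cong pred (trans (sym eq) (cong suc (trans (length-++ Z) (+-comm (length Z) 1)))))

      last-letter : nth blk (c ∷ Z ∷ʳ u) (suc k′) ≡ u
      last-letter = trans (cong (nth blk (c ∷ Z ∷ʳ u)) (sym length-init)) (nth-∷ʳ blk (c ∷ Z) u)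

      last-but-one : nth blk (c ∷ Z ∷ʳ u) k′ ≡ end c Z
      last-but-one = trans (cong (nth blk (c ∷ Z ∷ʳ u)) (sym (cong pred length-init)))
        (trans (nth-++ˡ blk (c ∷ Z) [ u ] ≤-refl) (sym (end-nth blk c Z)))

    single-right : ∀ w z Z → length (w ∷ z ∷ Z) ≡ k → isL w ≡ false → balanced (one true ∷ w ∷ z ∷ Z)
    single-right w z Z eq w≢ = unpaired ρ 0 refl (cong (_∧ true) w≢) z≤n
      (subst (λ r → 24 * rule-total k r (cost k (after k r V)) ≤ 2 * N * (potential ρ + 168 + 0)) (sym (oneRule-right w w≢))
        (≤-trans (≤-reflexive (cong (24 *_) (single-total k 2≤k true (cost k (blk ∷ z ∷ Z)))))
                 (right-bound (one true) w z Z 0 eq (local-right (end z Z) w z w≢))))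
      where
      V = w ∷ z ∷ Z
      ρ = one true ∷ V

    paired-right : ∀ z Z → length (one false ∷ z ∷ Z) ≡ k → balanced (one true ∷ one false ∷ z ∷ Z)
    paired-right z Z eq = begin
      24 * (root ρ + root (rotate ρ)) + 2 * N * (8 * 1 + P * 0)
        ≡⟨ cong (λ r → 24 * (root ρ + r) + 2 * N * (8 * 1 + P * 0)) turned ⟩
      24 * (root ρ + rule-total k (pair false) (cost k (rotate (blk ∷ z ∷ Z)))) + 2 * N * (8 * 1 + P * 0)
        ≤⟨ +-monoˡ-≤ _ (pair-bound z Z eq) ⟩
      4 * N * (potential ρ + 164) + 2 * N * (8 * 1 + P * 0)
        -- An equality: raising 164 to 168 in both rotations uses up the 8.
        ≡⟨ rearrange N (potential ρ) ⟩
      2 * N * (P + P * 1)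
        ≤⟨ *-monoʳ-≤ (2 * N) (+-monoˡ-≤ (P * 1) (m≤m+n P (slack ρ))) ⟩
      2 * N * (P + slack ρ + P * 1) ∎
      where
      open ≤-Reasoning
      ρ = one true ∷ one false ∷ z ∷ Z
      P = potential ρ + 168
      V′ = z ∷ Z ∷ʳ one true
      eq′ : length V′ ≡ k
      eq′ = trans (length-++ (z ∷ Z)) (trans (+-comm (length (z ∷ Z)) 1) eq)
      turned : root (rotate ρ) ≡ rule-total k (pair false) (cost k (rotate (blk ∷ z ∷ Z)))
      turned = trans
        (cong (λ u → rule-total k (oneRule false u) (cost k (after k (oneRule false u) V′))) (last-letter z Z (one true) eq′))
        (cong (λ V → rule-total k (pair false) (cost k V))
          (trans (cong (λ j → update j (λ _ → blk) V′) (sym (length-init z Z (one true) eq′))) (update-∷ʳ (λ _ → blk) (z ∷ Z) (one true))))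
      rearrange : ∀ n p → 4 * n * (p + 164) + 2 * n * (8 * 1 + (p + 168) * 0) ≡ 2 * n * ((p + 168) + (p + 168) * 1)
      rearrange = solve-∀

    -- The cost of this rotation is charged to the previous one, so only the potential handed over
    -- remains on the left.
    paired-left : ∀ V → pairAt k 0 (one false ∷ V) ≡ true → pairAt 0 1 (one false ∷ V) ≡ false → balanced (one false ∷ V)
    paired-left V q p rewrite q | p = *-monoʳ-≤ (2 * N) (≤-trans (≤-reflexive (*-identityʳ P))
      (≤-trans (m≤m+n P (slack ρ)) (m≤m+n (P + slack ρ) (P * 0))))
      where
      ρ = one false ∷ V
      P = potential ρ + 168

    single-left : ∀ c Z u → length (c ∷ Z ∷ʳ u) ≡ k → isR u ≡ false → pairAt 0 1 (one false ∷ c ∷ Z ∷ʳ u) ≡ false →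
                  balanced (one false ∷ c ∷ Z ∷ʳ u)
    single-left c Z u eq u≢ p = unpaired ρ 0 (trans (cong isR (last-letter c Z u eq)) u≢) p z≤n
      (subst (λ r → 24 * rule-total k r (cost k (after k r V)) ≤ 2 * N * (potential ρ + 168 + 0))
        (sym (trans (cong (oneRule false) (last-letter c Z u eq)) (oneRule-left u u≢)))
        (≤-trans (≤-reflexive (cong (24 *_) (single-total k 2≤k false (cost k (update (suc k′) (λ _ → blk) V)))))
                 (left-bound (one false) c Z u 0 eq (local-left (end c Z) u c u≢))))
      where
      V = c ∷ Z ∷ʳ u
      ρ = one false ∷ V

    no-pair-at-blk : ∀ b → (b ∧ false) ≡ false
    no-pair-at-blk true  = refl
    no-pair-at-blk false = refl

    extend-right : ∀ r z Z → length (one r ∷ z ∷ Z) ≡ k → balanced (blk ∷ one r ∷ z ∷ Z)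
    extend-right r z Z eq = unpaired ρ (4 * bit (pairAt 1 2 ρ)) refl (no-pair-at-blk (isL (one r))) (m≤m+n _ _)
      (≤-trans (≤-reflexive (cong (24 *_) (extend-total k 2≤k true (cost k (blk ∷ z ∷ Z)))))
               (right-bound blk (one r) z Z _ eq (local-blk-right (end z Z) r z)))
      where ρ = blk ∷ one r ∷ z ∷ Z

    extend-left : ∀ Z r → length (blk ∷ Z ∷ʳ one r) ≡ k → balanced (blk ∷ blk ∷ Z ∷ʳ one r)
    extend-left Z r eq = unpaired ρ (4 * bit (pairAt (suc k′) k ρ)) refl refl (m≤n+m _ (4 * bit (pairAt 1 2 ρ)))
      (subst (λ q → 24 * rule-total k q (cost k (after k q V)) ≤ 2 * N * (potential ρ + 168 + 4 * bit (pairAt (suc k′) k ρ)))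
        (sym (cong (blkRule blk) (last-letter blk Z (one r) eq)))
        (≤-trans (≤-reflexive (cong (24 *_) (extend-total k 2≤k false (cost k (update (suc k′) (λ _ → blk) V)))))
                 (left-bound blk blk Z (one r) _ eq
                   (subst (λ e → 79 ≤ local (end blk Z) (one r) blk blk + 4 * bit e)
                     (sym (cong₂ (λ t u → isL t ∧ isR u) (last-letter blk Z (one r) eq) (last-but-one blk Z (one r) eq)))
                     (local-blk-left (end blk Z) r blk)))))
      where
      V = blk ∷ Z ∷ʳ one r
      ρ = blk ∷ V

    merge-blocks : ∀ z Z → length (blk ∷ z ∷ Z) ≡ k → nth blk (z ∷ Z) k′ ≡ blk → balanced (blk ∷ blk ∷ z ∷ Z)
    merge-blocks z Z eq last = unpaired ρ 0 refl refl z≤n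
      (subst (λ r → 24 * rule-total k r (cost k (after k r V)) ≤ 2 * N * (potential ρ + 168 + 0))
        (sym (cong (blkRule blk) last))
        (≤-trans (blocks-bound V (potential ρ) eq (≤-trans (potential-join blk blk z Z 39 0 (local-blk (end z Z))) (≤-reflexive (+-identityʳ (potential ρ)))))
                 (*-monoʳ-≤ (2 * N) (m≤m+n _ 0))))
      where
      V = blk ∷ z ∷ Z
      ρ = blk ∷ V
      local-blk : ∀ l → 82 ≤ local l blk blk z + 0
      local-blk (one true)  = ≤-refl
      local-blk (one false) = ≤-refl
      local-blk blk         = ≤-refl

    balance : ∀ t V → length V ≡ k → balanced (t ∷ V)
    balance (one true) (one false ∷ z ∷ Z) eq = paired-right z Z eq
    balance (one true) (one true ∷ z ∷ Z)  eq = single-right (one true) z Z eq refl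
    balance (one true) (blk ∷ z ∷ Z)       eq = single-right blk z Z eq refl
    balance (one false) V eq with toEnds V eq
    ... | ends c Z (one true)  = paired-left (c ∷ Z ∷ʳ one true) (cong isR (last-letter c Z (one true) eq)) (no-pair-at-blk (isL c))
    ... | ends c Z (one false) = single-left c Z (one false) eq refl (no-pair-at-blk (isL c))
    ... | ends c Z blk         = single-left c Z blk eq refl (no-pair-at-blk (isL c))
    balance blk (one r ∷ z ∷ Z) eq = extend-right r z Z eq
    -- The left neighbour is the last letter. It is inspected before the word is split at its end,
    -- because `merge-blocks` takes the word from its front and `extend-left` from its end.
    balance blk (blk ∷ z ∷ Z)   eq = by-last (nth blk (z ∷ Z) k′) refl (toEnds (blk ∷ z ∷ Z) eq)
      where
      by-last : ∀ u → nth blk (z ∷ Z) k′ ≡ u → Ends (blk ∷ z ∷ Z) → balanced (blk ∷ blk ∷ z ∷ Z)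
      by-last blk     h e = merge-blocks z Z eq h
      by-last (one r) h e = from e eq h
        where
        from : ∀ {V} → Ends (blk ∷ V) → length (blk ∷ V) ≡ k → nth blk (blk ∷ V) (suc k′) ≡ one r → balanced (blk ∷ blk ∷ V)
        from (ends .blk Z u) eq h with refl ← trans (sym (last-letter blk Z u eq)) h = extend-left Z r eq

    total-bound : ∀ W → length W ≡ suc k → 24 * ∑ (stacks (suc k)) (cost (suc k) W) ≤ count (suc k) * (potential W + 168)
    total-bound W eq = begin
      24 * ∑ (stacks (suc k)) (cost (suc k) W)   ≡⟨ cong (24 *_) (trans (∑-cost W) split-roots) ⟩
      24 * (∑ I H + ∑ I G)                       ≤⟨ ∑-balance I H G p q p′ q′ N P Σq Σp′ Σq′ pointwise ⟩
      2 * N * (length I * P)                     ≡⟨ cong (λ l → 2 * N * (l * P)) (length-upTo (suc k)) ⟩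
      2 * N * (suc k * P)                        ≡⟨ rearrange N (suc k) P ⟩
      suc k * (2 * N) * P                        ≡⟨ cong (_* P) (count-suc k) ⟨
      count (suc k) * P                          ∎
      where
      open ≤-Reasoning
      I = upTo (suc k)
      P = potential W + 168
      ρ : ℕ → Word
      ρ = iterate rotate W
      ρ-length : ∀ i → length (ρ i) ≡ suc k
      ρ-length i = trans (length-iterate-rotate i W) eq
      H G p q p′ q′ : ℕ → ℕ
      H i = if pairAt k 0 (ρ i) then 0 else root (ρ i)
      G i = if pairAt 0 1 (ρ i) then root (rotate (ρ i)) else 0
      p i = bit (pairAt 0 1 (ρ i))
      q i = bit (pairAt k 0 (ρ i))
      p′ i = bit (pairAt 1 2 (ρ i))
      q′ i = bit (pairAt (suc k′) k (ρ i))
      pointwise : ∀ i → 24 * (H i + G i) + 2 * N * (8 * p i + P * q i) ≤ 2 * N * (P + (4 * p′ i + 4 * q′ i) + P * p i)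
      pointwise i = subst (λ φ → 24 * (H i + G i) + 2 * N * (8 * p i + (φ + 168) * q i) ≤
                                 2 * N * (φ + 168 + (4 * p′ i + 4 * q′ i) + (φ + 168) * p i))
        (potential-iterate i W) (from (ρ i) (ρ-length i))
        where
        from : ∀ ρ → length ρ ≡ suc k → balanced ρ
        from (t ∷ V) e = balance t V (cong pred e)
      -- One rotation moves position `i` to `dec k i`, and a sum over the full turn does not notice
      -- it. The positions run through (1,2), (0,1), (k,0) and (k-1,k).
      pairs : ∀ {i j} → i ≤ k → j ≤ k → ∑ I (λ h → bit (pairAt (dec k i) (dec k j) (ρ h))) ≡ ∑ I (λ h → bit (pairAt i j (ρ h)))
      pairs {i} {j} i≤k j≤k = trans (sym (∑-rotations (suc k) W (bit ∘ pairAt (dec k i) (dec k j)) eq))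
        (∑-cong I (λ h → cong bit (pairAt-rotate (ρ h) (ρ-length h) i≤k j≤k)))
      Σp′ : ∑ I p′ ≡ ∑ I p
      Σp′ = sym (pairs {1} {2} (s≤s z≤n) (s≤s (s≤s z≤n)))
      Σq : ∑ I q ≡ ∑ I p
      Σq = pairs {0} {1} z≤n (s≤s z≤n)
      Σq′ : ∑ I q′ ≡ ∑ I p
      Σq′ = trans (pairs {k} {0} ≤-refl z≤n) Σq
      R : ℕ → ℕ
      R i = if pairAt k 0 (ρ i) then root (ρ i) else 0
      -- Reindexing by one rotation moves the roots that start with the left-wanting half of a pair
      -- to the rotation that starts with its partner.
      split-roots : ∑ I (λ i → root (ρ i)) ≡ ∑ I H + ∑ I G
      split-roots = trans (∑-cong I (λ i → halves (pairAt k 0 (ρ i)) (root (ρ i)))) (trans (∑-+ I H R) (cong (∑ I H +_)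
        (trans (sym (∑-rotations (suc k) W (λ ρ → if pairAt k 0 ρ then root ρ else 0) eq))
               (∑-cong I (λ i → cong (λ b → if b then root (rotate (ρ i)) else 0) (pairAt-rotate {k} {0} {1} (ρ i) (ρ-length i) z≤n (s≤s z≤n)))))))
        where
        halves : ∀ b r → r ≡ (if b then 0 else r) + (if b then r else 0)
        halves true  r = refl
        halves false r = sym (+-identityʳ r)
      rearrange : ∀ n m p → 2 * n * (m * p) ≡ m * (2 * n) * p
      rearrange = solve-∀

small : ∀ m W → (∀ x → cost m W x ≡ 7) → 24 * ∑ (stacks m) (cost m W) ≤ count m * (potential W + 168)
small m W eq = begin
  24 * ∑ (stacks m) (cost m W)      ≡⟨ cong (24 *_) (trans (∑-cong (stacks m) eq) (∑-stacks-const m 7)) ⟩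
  24 * (count m * 7)                ≡⟨ rearrange (count m) ⟩
  count m * 168                     ≤⟨ *-monoʳ-≤ (count m) (m≤n+m 168 (potential W)) ⟩
  count m * (potential W + 168)     ∎
  where
  open ≤-Reasoning
  rearrange : ∀ n → 24 * (n * 7) ≡ n * 168
  rearrange = solve-∀

cost-bound : ∀ m W → length W ≡ m → 24 * ∑ (stacks m) (cost m W) ≤ count m * (potential W + 168)
cost-bound zero                 W eq = small 0 W (λ _ → refl)
cost-bound (suc zero)           W eq = small 1 W (λ _ → refl)
cost-bound (suc (suc zero))     W eq = small 2 W (λ _ → refl)
cost-bound (suc (suc (suc k′))) W eq = total-bound k′ (cost-bound (suc (suc k′))) W eq

-- Realisation by flips

orient : Bool → List ℕ → List ℕ
orient true  c = c
orient false c = reverse c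

-- `cs` lists the contents of the blocks by label, each in increasing cyclic order; sign `true`
-- shows a block in this order from the top.
layout : List (List ℕ) → Stack → List ℕ
layout cs []            = []
layout cs ((j , σ) ∷ x) = orient σ (nth [] cs j) ++ layout cs x

record Reach (c : ℕ) (π π′ : List ℕ) : Set where
  constructor reach
  field
    flips   : List ℕ
    short   : length flips ≤ c
    valid   : All (ValidFlip (length π)) flips
    correct : applyFlips flips π ≡ π′

length-flip : ∀ i π → length (flip i π) ≡ length π
length-flip i π = begin
  length (reverse (take i π) ++ drop i π)        ≡⟨ length-++ (reverse (take i π)) ⟩
  length (reverse (take i π)) + length (drop i π) ≡⟨ cong (_+ length (drop i π)) (length-reverse (take i π)) ⟩
  length (take i π) + length (drop i π)          ≡⟨ length-++ (take i π) ⟨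
  length (take i π ++ drop i π)                  ≡⟨ cong length (take++drop≡id i π) ⟩
  length π                                       ∎
  where open ≡-Reasoning

length-applyFlips : ∀ fs π → length (applyFlips fs π) ≡ length π
length-applyFlips []       π = refl
length-applyFlips (i ∷ fs) π = trans (length-applyFlips fs (flip i π)) (length-flip i π)

applyFlips-++ : ∀ fs gs π → applyFlips (fs ++ gs) π ≡ applyFlips gs (applyFlips fs π)
applyFlips-++ []       gs π = refl
applyFlips-++ (i ∷ fs) gs π = applyFlips-++ fs gs (flip i π)

infixr 5 _then_
_then_ : ∀ {c d π π′ π″} → Reach c π π′ → Reach d π′ π″ → Reach (c + d) π π″
_then_ {π = π} (reach fs l v refl) (reach gs l′ v′ refl) = reach (fs ++ gs)
  (≤-trans (≤-reflexive (length-++ fs)) (+-mono-≤ l l′))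
  (All.++⁺ v (subst (λ n → All (ValidFlip n) gs) (length-applyFlips fs π) v′))
  (applyFlips-++ fs gs π)

stay : ∀ {π} → Reach 0 π π
stay = reach [] z≤n [] refl

between : ∀ {c π ρ ρ′ π′} → π ≡ ρ → Reach c ρ ρ′ → ρ′ ≡ π′ → Reach c π π′
between refl r refl = r

weaken : ∀ {c d π π′} → c ≤ d → Reach c π π′ → Reach d π π′
weaken le (reach fs l v e) = reach fs (≤-trans l le) v e

NonEmpty : List ℕ → Set
NonEmpty xs = 1 ≤ length xs

flipPrefix : ∀ X Y → NonEmpty X → Reach 1 (X ++ Y) (reverse X ++ Y)
flipPrefix X Y ne = reach [ length X ] ≤-refl
  ((ne , ≤-trans (m≤m+n (length X) (length Y)) (≤-reflexive (sym (length-++ X)))) ∷ [])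
  (cong₂ (λ A B → reverse A ++ B) (take-length X) (drop-length X))
  where
  take-length : ∀ X → take (length X) (X ++ Y) ≡ X
  take-length []      = refl
  take-length (x ∷ X) = cong (x ∷_) (take-length X)
  drop-length : ∀ X → drop (length X) (X ++ Y) ≡ Y
  drop-length []      = refl
  drop-length (x ∷ X) = drop-length X

nonEmpty-++ : ∀ X Y → NonEmpty X → NonEmpty (X ++ Y)
nonEmpty-++ (x ∷ X) Y ne = s≤s z≤n

nonEmpty-++ʳ : ∀ X Y → NonEmpty Y → NonEmpty (X ++ Y)
nonEmpty-++ʳ []      Y ne = ne
nonEmpty-++ʳ (x ∷ X) Y ne = s≤s z≤n

nonEmpty-reverse : ∀ X → NonEmpty X → NonEmpty (reverse X)
nonEmpty-reverse X ne = ≤-trans ne (≤-reflexive (sym (length-reverse X)))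

nonEmpty-orient : ∀ σ X → NonEmpty X → NonEmpty (orient σ X)
nonEmpty-orient true  X ne = ne
nonEmpty-orient false X ne = nonEmpty-reverse X ne

orient-not : ∀ σ c → orient (not σ) c ≡ reverse (orient σ c)
orient-not true  c = refl
orient-not false c = sym (reverse-involutive c)

join : Bool → List ℕ → List ℕ → List ℕ
join true  c n = c ++ n
join false c n = n ++ c

orient-join : ∀ s c n → orient s (join s c n) ≡ orient s c ++ orient s n
orient-join true  c n = refl
orient-join false c n = reverse-++ n c

orient-join-not : ∀ s c n → orient (not s) (join s c n) ≡ orient (not s) n ++ orient (not s) c
orient-join-not true  c n = reverse-++ c n
orient-join-not false c n = refl

layout-++ : ∀ cs A B → layout cs (A ++ B) ≡ layout cs A ++ layout cs B
layout-++ cs []            B = refl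
layout-++ cs ((j , σ) ∷ A) B = trans (cong (orient σ (nth [] cs j) ++_) (layout-++ cs A B)) (sym (++-assoc (orient σ (nth [] cs j)) _ _))

layout-turn : ∀ cs A → layout cs (turn A) ≡ reverse (layout cs A)
layout-turn cs []            = refl
layout-turn cs ((j , σ) ∷ A) = begin
  layout cs (turn ((j , σ) ∷ A))                       ≡⟨ cong (layout cs) (turn-++ [ (j , σ) ] A) ⟩
  layout cs (turn A ++ [ (j , not σ) ])                ≡⟨ layout-++ cs (turn A) _ ⟩
  layout cs (turn A) ++ (orient (not σ) c ++ [])       ≡⟨ cong₂ _++_ (layout-turn cs A) (trans (++-identityʳ _) (orient-not σ c)) ⟩
  reverse (layout cs A) ++ reverse (orient σ c)        ≡⟨ reverse-++ (orient σ c) (layout cs A) ⟨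
  reverse (orient σ c ++ layout cs A)                  ∎
  where
  open ≡-Reasoning
  c = nth [] cs j

layout-update-∉ : ∀ {a} f cs A → a ∉ labels A → layout (update a f cs) A ≡ layout cs A
layout-update-∉ f cs []            a∉ = refl
layout-update-∉ f cs ((j , σ) ∷ A) a∉ =
  cong₂ (λ c X → orient σ c ++ X) (nth-update-≢ [] f cs (λ eq → a∉ (here (sym eq)))) (layout-update-∉ f cs A (a∉ ∘ there))

layout-update : ∀ {a τ} f cs A D → a < length cs → a ∉ labels A → a ∉ labels D →
                layout (update a f cs) (A ++ (a , τ) ∷ D) ≡ layout cs A ++ orient τ (f (nth [] cs a)) ++ layout cs D
layout-update {a} {τ} f cs A D a< a∉A a∉D = trans (layout-++ (update a f cs) A _)
  (cong₂ _++_ (layout-update-∉ f cs A a∉A) (cong₂ (λ c X → orient τ c ++ X) (nth-update [] a f cs a<) (layout-update-∉ f cs D a∉D)))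

module _ {a : ℕ} (cs : List (List ℕ)) (a< : a < length cs) (s : Bool) (c : List ℕ) (ne : NonEmpty c) where

  private
    n = nth [] cs a
    cs′ = update a (join s c) cs

  -- The top block shows sign `not s`. Reversing all that lies above the neighbour turns it once and
  -- brings it next to the neighbour, in the order of `join s`.
  insert-above : ∀ {y} → Split a y → sign a y ≡ s →
                 Reach 1 (reverse (orient s c) ++ layout cs y) (layout cs′ (flipTo a y))
  insert-above (split A τ D a∉A a∉D) eq with refl ← trans (sym (sign-split A D a∉A)) eq =
    between (sym start)
      (flipPrefix (X ++ LA) (orient s n ++ LD) (nonEmpty-++ X LA (nonEmpty-reverse (orient s c) (nonEmpty-orient s c ne))))
      stop
    where
    open ≡-Reasoning
    X = reverse (orient s c)
    LA = layout cs A
    LD = layout cs D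
    start : (X ++ LA) ++ orient s n ++ LD ≡ X ++ layout cs (A ++ (a , s) ∷ D)
    start = trans (++-assoc X LA _) (cong (X ++_) (sym (layout-++ cs A _)))
    stop : reverse (X ++ LA) ++ orient s n ++ LD ≡ layout cs′ (flipTo a (A ++ (a , s) ∷ D))
    stop = begin
      reverse (X ++ LA) ++ orient s n ++ LD                    ≡⟨ cong (_++ orient s n ++ LD) (reverse-++ X LA) ⟩
      (reverse LA ++ reverse X) ++ orient s n ++ LD            ≡⟨ ++-assoc (reverse LA) _ _ ⟩
      reverse LA ++ reverse X ++ orient s n ++ LD              ≡⟨ cong (λ Y → reverse LA ++ Y ++ orient s n ++ LD) (reverse-involutive (orient s c)) ⟩
      reverse LA ++ orient s c ++ orient s n ++ LD             ≡⟨ cong (reverse LA ++_) (++-assoc (orient s c) _ _) ⟨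
      reverse LA ++ (orient s c ++ orient s n) ++ LD           ≡⟨ cong₂ (λ Y Z → Y ++ Z ++ LD) (sym (layout-turn cs A)) (sym (orient-join s c n)) ⟩
      layout cs (turn A) ++ orient s (join s c n) ++ LD        ≡⟨ layout-update (join s c) cs (turn A) D a< (∉-turn A a∉A) a∉D ⟨
      layout cs′ (turn A ++ (a , s) ∷ D)                       ≡⟨ cong (layout cs′) (flipTo-split A D a∉A) ⟨
      layout cs′ (flipTo a (A ++ (a , s) ∷ D))                 ∎

  -- The first flip includes the neighbour and brings the top block underneath it. The second turns
  -- the neighbour and everything above it back, so only the top block has moved.
  insert-below : NonEmpty n → ∀ {y} → Split a y → sign a y ≡ not s →
                 Reach 2 (reverse (orient (not s) c) ++ layout cs y) (layout cs′ y)
  insert-below nn (split A τ D a∉A a∉D) eq with refl ← trans (sym (sign-split A D a∉A)) eq =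
    between (sym start)
      (flipPrefix (X ++ LA ++ Y) LD (nonEmpty-++ X (LA ++ Y) (nonEmpty-reverse (orient (not s) c) (nonEmpty-orient (not s) c ne)))
        then between (sym middle)
          (flipPrefix (reverse (LA ++ Y)) (reverse X ++ LD)
            (nonEmpty-reverse (LA ++ Y) (nonEmpty-++ʳ LA Y (nonEmpty-orient (not s) n nn)))) stop)
      refl
    where
    X = reverse (orient (not s) c)
    Y = orient (not s) n
    LA = layout cs A
    LD = layout cs D
    start : (X ++ LA ++ Y) ++ LD ≡ X ++ layout cs (A ++ (a , not s) ∷ D)
    start = trans (++-assoc X _ LD) (cong (X ++_) (trans (++-assoc LA Y LD) (sym (layout-++ cs A _))))
    middle : reverse (LA ++ Y) ++ reverse X ++ LD ≡ reverse (X ++ LA ++ Y) ++ LD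
    middle = trans (sym (++-assoc (reverse (LA ++ Y)) (reverse X) LD)) (cong (_++ LD) (sym (reverse-++ X (LA ++ Y))))
    stop : reverse (reverse (LA ++ Y)) ++ reverse X ++ LD ≡ layout cs′ (A ++ (a , not s) ∷ D)
    stop = begin
      reverse (reverse (LA ++ Y)) ++ reverse X ++ LD     ≡⟨ cong₂ (λ B C → B ++ C ++ LD) (reverse-involutive (LA ++ Y)) (reverse-involutive (orient (not s) c)) ⟩
      (LA ++ Y) ++ orient (not s) c ++ LD                ≡⟨ ++-assoc LA Y _ ⟩
      LA ++ Y ++ orient (not s) c ++ LD                  ≡⟨ cong (LA ++_) (++-assoc Y _ LD) ⟨
      LA ++ (Y ++ orient (not s) c) ++ LD                ≡⟨ cong (λ B → LA ++ B ++ LD) (orient-join-not s c n) ⟨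
      LA ++ orient (not s) (join s c n) ++ LD            ≡⟨ layout-update (join s c) cs A D a< a∉A a∉D ⟨
      layout cs′ (A ++ (a , not s) ∷ D)                  ∎
      where open ≡-Reasoning

  turn-top : ∀ σ π → Reach 1 (orient σ c ++ π) (reverse (orient σ c) ++ π)
  turn-top σ π = flipPrefix (orient σ c) π (nonEmpty-orient σ c ne)

-- A singleton looks the same in both orientations.
layout-setSign : ∀ {a p y} b cs → nth [] cs a ≡ [ p ] → layout cs (setSign a b y) ≡ layout cs y
layout-setSign {y = []}              b cs eq = refl
layout-setSign {a} {p} {(j , σ) ∷ y} b cs eq = cong₂ _++_ letter (layout-setSign {y = y} b cs eq)
  where
  singleton : ∀ τ → orient τ (nth [] cs a) ≡ [ p ]
  singleton true  = eq
  singleton false = cong reverse eq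
  letter : orient (if j ≡ᵇ a then b else σ) (nth [] cs j) ≡ orient σ (nth [] cs j)
  letter with j ≟ a
  ... | yes refl rewrite ≡ᵇ-refl j = trans (singleton b) (sym (singleton σ))
  ... | no j≢a rewrite ≡ᵇ-≢ j≢a = refl

-- From block moves to flips: contents, types and rules.

data Fits : Type → List ℕ → Set where
  one : ∀ {s p} → Fits (one s) [ p ]
  blk : ∀ {p ps} → Fits blk (p ∷ ps)

fits-nonEmpty : ∀ {t c} → Fits t c → NonEmpty c
fits-nonEmpty one = s≤s z≤n
fits-nonEmpty blk = s≤s z≤n

nonEmpty-fits : ∀ {c} → NonEmpty c → Fits blk c
nonEmpty-fits {_ ∷ _} _ = blk

fits-one : ∀ {s c} → Fits (one s) c → ∃ λ p → c ≡ [ p ]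
fits-one (one {p = p}) = p , refl

fits-nth : ∀ {V cs j} → Pointwise Fits V cs → j < length V → Fits (nth blk V j) (nth [] cs j)
fits-nth {j = zero}  (f ∷ fs) lt       = f
fits-nth {j = suc j} (f ∷ fs) (s≤s lt) = fits-nth fs lt

fits-update : ∀ {V cs j t f} → Pointwise Fits V cs → j < length V → Fits t (f (nth [] cs j)) →
              Pointwise Fits (update j (λ _ → t) V) (update j f cs)
fits-update {j = zero}  (_ ∷ fs) lt       g = g ∷ fs
fits-update {j = suc j} (f ∷ fs) (s≤s lt) g = f ∷ fits-update fs lt g

fits-rotate : ∀ {V cs} → Pointwise Fits V cs → Pointwise Fits (rotate V) (rotate cs)
fits-rotate []       = []
fits-rotate (f ∷ fs) = Pointwise.++⁺ fs (f ∷ [])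

update-nth : ∀ {A : Set} {d x : A} V {j} → nth d V j ≡ x → update j (λ _ → x) V ≡ V
update-nth []      {j}     eq = refl
update-nth (t ∷ V) {zero}  eq = cong (_∷ V) (sym eq)
update-nth (t ∷ V) {suc j} eq = cong (t ∷_) (update-nth V eq)

join-nonEmpty : ∀ s c n → NonEmpty c → NonEmpty (join s c n)
join-nonEmpty true  c n ne = nonEmpty-++ c n ne
join-nonEmpty false c n ne = nonEmpty-++ʳ n c ne

==⇒≡ : ∀ {t s} → (t == s) ≡ true → t ≡ s
==⇒≡ {true}  {true}  refl = refl
==⇒≡ {false} {false} refl = refl

==⇒≡not : ∀ {t s} → (t == s) ≡ false → t ≡ not s
==⇒≡not {true}  {false} refl = refl
==⇒≡not {false} {true}  refl = refl

reverse-orient-not : ∀ σ c → reverse (orient (not σ) c) ≡ orient σ c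
reverse-orient-not true  c = reverse-involutive c
reverse-orient-not false c = refl

reverse-orient-singleton : ∀ τ σ p → reverse (orient τ [ p ]) ≡ orient σ [ p ]
reverse-orient-singleton true  true  p = refl
reverse-orient-singleton true  false p = refl
reverse-orient-singleton false true  p = refl
reverse-orient-singleton false false p = refl

module _ {k : ℕ} (2≤k : 2 ≤ k) (c : List ℕ) (ne : NonEmpty c) (cs : List (List ℕ)) (len : length cs ≡ k) where

  private
    at′ : ∀ s {y} → Valid k y → Split (side k s) y
    at′ s {y} = at k (side-< 2≤k s) {y}

    in-range : ∀ s → side k s < length cs
    in-range s = subst (side k s <_) (sym len) (side-< 2≤k s)

  joined : Bool → List (List ℕ)
  joined s = update (side k s) (join s c) cs

  land-above : ∀ s {y} → Valid k y → sign (side k s) y ≡ s →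
               Reach 1 (reverse (orient s c) ++ layout cs y) (layout (joined s) (flipTo (side k s) y))
  land-above s v = insert-above cs (in-range s) s c ne (at′ s v)

  land-below : ∀ s {y} → NonEmpty (nth [] cs (side k s)) → Valid k y → sign (side k s) y ≡ not s →
               Reach 2 (reverse (orient (not s) c) ++ layout cs y) (layout (joined s) y)
  land-below s nn v = insert-below cs (in-range s) s c ne nn (at′ s v)

  single-step : ∀ s σ {y} → (∀ τ → reverse (orient τ c) ≡ orient σ c) → NonEmpty (nth [] cs (side k s)) → Valid k y →
                Reach (price k (single s) σ y) (orient σ c ++ layout cs y) (layout (joined s) (move k (single s) σ y))
  single-step s σ {y} free nn v with sign (side k s) y == s in eq
  ... | true  = between (cong (_++ layout cs y) (sym (free s))) (land-above s v (==⇒≡ eq)) refl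
  ... | false = between (cong (_++ layout cs y) (sym (free (not s)))) (land-below s nn v (==⇒≡not eq)) refl

  pair-step : ∀ s σ {p y} → (∀ τ → reverse (orient τ c) ≡ orient σ c) → nth [] cs (side k s) ≡ [ p ] → Valid k y →
              Reach (price k (pair s) σ y) (orient σ c ++ layout cs y) (layout (joined s) (move k (pair s) σ y))
  pair-step s σ {p} {y} free eq v = between
    (cong₂ _++_ (sym (free s)) (sym (layout-setSign {y = y} s cs eq)))
    (land-above s (resign-valid _ {y} v) (sign-setSign s (at′ s {y} v))) refl

  extend-step : ∀ s σ {p y} → nth [] cs (side k s) ≡ [ p ] → Valid k y →
                Reach (price k (extend s) σ y) (orient σ c ++ layout cs y) (layout (joined s) (move k (extend s) σ y))
  extend-step s σ {p} {y} eq v with σ == s in e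
  ... | true with refl ← ==⇒≡ {σ} {s} e = between
    (cong₂ _++_ (sym (reverse-orient-not s c)) (sym (layout-setSign {y = y} (not s) cs eq)))
    (land-below s (subst NonEmpty (sym eq) ≤-refl) (resign-valid _ {y} v) (sign-setSign (not s) (at′ s {y} v))) refl
  ... | false with refl ← ==⇒≡not {σ} {s} e = between
    (cong₂ _++_ (orient-not s c) (sym (layout-setSign {y = y} s cs eq)))
    (land-above s (resign-valid _ {y} v) (sign-setSign s (at′ s {y} v))) refl

  -- The direction is an existential witness because it depends on the signs and the order of the
  -- neighbours. The last two branches spend one flip on `turn-top`.
  blocks-step : ∀ σ {y} → (∀ s → NonEmpty (nth [] cs (side k s))) → Valid k y →
                ∃ λ s → Reach (price k blocks σ y) (orient σ c ++ layout cs y) (layout (joined s) (move k blocks σ y))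
  blocks-step σ {y} nn v with sign (side k (not σ)) y == not σ in e₁
  ... | true = not σ , between (cong (_++ layout cs y) (sym (reverse-orient-not σ c))) (land-above (not σ) v (==⇒≡ e₁)) refl
  ... | false with sign (side k σ) y == not σ in e₂
  ...   | true = σ , between (cong (_++ layout cs y) (sym (reverse-orient-not σ c))) (land-below σ (nn σ) v (==⇒≡ e₂)) refl
  ...   | false with above (side k σ) (side k (not σ)) y
  ...     | true = σ , (turn-top cs (in-range σ) σ c ne σ (layout cs y) then
              land-above σ v (trans (==⇒≡not e₂) (not-involutive σ)))
  ...     | false = not σ , (turn-top cs (in-range σ) σ c ne σ (layout cs y) then
              between (cong (λ τ → reverse (orient τ c) ++ layout cs y) (sym (not-involutive σ)))
                (land-below (not σ) (nn (not σ)) v (==⇒≡not e₁)) refl)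

record Step (k : ℕ) (r : Rule) (V : Word) (c : List ℕ) (cs : List (List ℕ)) (σ : Bool) (y : Stack) : Set where
  constructor step
  field
    direction : Bool
    fits      : Pointwise Fits (after k r V) (update (side k direction) (join direction c) cs)
    reached   : Reach (price k r σ y) (orient σ c ++ layout cs y)
                      (layout (update (side k direction) (join direction c) cs) (move k r σ y))

module _ {k : ℕ} (2≤k : 2 ≤ k) {V : Word} {cs : List (List ℕ)} (lenV : length V ≡ k) (fs : Pointwise Fits V cs) where

  private
    len : length cs ≡ k
    len = trans (sym (Pointwise.Pointwise-length fs)) lenV

    neighbour : ∀ s → Fits (nth blk V (side k s)) (nth [] cs (side k s))
    neighbour s = fits-nth fs (subst (side k s <_) (sym lenV) (side-< 2≤k s))

    joined-fits : ∀ s c → NonEmpty c → Pointwise Fits (update (side k s) (λ _ → blk) V) (update (side k s) (join s c) cs)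
    joined-fits s c ne = fits-update fs (subst (side k s <_) (sym lenV) (side-< 2≤k s))
      (nonEmpty-fits (join-nonEmpty s c (nth [] cs (side k s)) ne))

  rule-step : ∀ t c σ y → Fits t c → Valid k y → Step k (rule k t V) V c cs σ y
  rule-step (one s) c σ y (one {p = p}) v = by-neighbour (nth blk V (side k s)) (neighbour s)
    where
    free : ∀ τ → reverse (orient τ [ p ]) ≡ orient σ [ p ]
    free τ = reverse-orient-singleton τ σ p
    by-neighbour : ∀ u → Fits u (nth [] cs (side k s)) → Step k (oneRule s u) V c cs σ y
    by-neighbour blk f = step s (joined-fits s c ≤-refl) (single-step 2≤k c ≤-refl cs len s σ free (fits-nonEmpty f) v)
    by-neighbour (one r) f with s == r
    ... | true  = step s (joined-fits s c ≤-refl) (single-step 2≤k c ≤-refl cs len s σ free (fits-nonEmpty f) v)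
    ... | false = step s (joined-fits s c ≤-refl) (pair-step 2≤k c ≤-refl cs len s σ free (proj₂ (fits-one f)) v)
  rule-step blk c σ y f v = by-neighbours (nth blk V (side k true)) (nth blk V (side k false)) refl refl (neighbour true) (neighbour false)
    where
    ne : NonEmpty c
    ne = fits-nonEmpty f
    by-neighbours : ∀ w u → nth blk V (side k true) ≡ w → nth blk V (side k false) ≡ u →
                    Fits w (nth [] cs (side k true)) → Fits u (nth [] cs (side k false)) → Step k (blkRule w u) V c cs σ y
    by-neighbours (one r) u       _ _ g h = step true (joined-fits true c ne) (extend-step 2≤k c ne cs len true σ (proj₂ (fits-one g)) v)
    by-neighbours blk     (one r) _ _ g h = step false (joined-fits false c ne) (extend-step 2≤k c ne cs len false σ (proj₂ (fits-one h)) v)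
    by-neighbours blk     blk     p q g h with blocks-step 2≤k c ne cs len σ (λ { true → fits-nonEmpty g ; false → fits-nonEmpty h }) v
    -- Both neighbours are blocks, so writing `blk` on either side leaves `V` unchanged.
    ... | s , reached = step s (subst (λ V′ → Pointwise Fits V′ (update (side k s) (join s c) cs)) (update-nth V (which s)) (joined-fits s c ne)) reached
      where
      which : ∀ s → nth blk V (side k s) ≡ blk
      which true  = p
      which false = q

-- Cyclic sortedness and the last two blocks.

record IsRotation (n : ℕ) (l : List ℕ) : Set where
  constructor rotation
  field
    amount : ℕ
    proof  : iterate rotate l amount ≡ sorted n

isRotation-comm : ∀ {n} X Y → IsRotation n (X ++ Y) → IsRotation n (Y ++ X)
isRotation-comm X Y (rotation i eq) = rotation (length Y + i)
  (trans (iterate-+ rotate (length Y) i (Y ++ X)) (trans (cong (λ l → iterate rotate l i) (iterate-rotate-++ Y X)) eq))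

isRotation-rotate : ∀ {n} cs → IsRotation n (concat cs) → IsRotation n (concat (rotate cs))
isRotation-rotate []       h = h
isRotation-rotate (c ∷ cs) h = subst (IsRotation _) eq (isRotation-comm c (concat cs) h)
  where
  eq : concat cs ++ c ≡ concat (cs ∷ʳ c)
  eq = trans (cong (concat cs ++_) (sym (++-identityʳ c))) (concat-++ cs [ c ])

-- Joining to the right only reassociates; joining to the left carries `c` from the front to the
-- end, which is a rotation.
isRotation-join : ∀ {n k} s c cs → length cs ≡ suc k → IsRotation n (concat (c ∷ cs)) →
                  IsRotation n (concat (update (side (suc k) s) (join s c) cs))
isRotation-join true c (n ∷ cs) len h = subst (IsRotation _) (sym (++-assoc c n (concat cs))) h
isRotation-join {k = k} false c cs len h with initLast cs
... | Z ∷ʳ′ u = subst (IsRotation _) eq (isRotation-comm c (concat (Z ∷ʳ u)) h)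
  where
  open ≡-Reasoning
  k≡ : k ≡ length Z
  k≡ = cong pred (trans (sym len) (trans (length-++ Z) (+-comm (length Z) 1)))
  eq : concat (Z ∷ʳ u) ++ c ≡ concat (update k (join false c) (Z ∷ʳ u))
  eq = begin
    concat (Z ∷ʳ u) ++ c                                    ≡⟨ cong (_++ c) (concat-++ Z [ u ]) ⟨
    (concat Z ++ u ++ []) ++ c                              ≡⟨ ++-assoc (concat Z) (u ++ []) c ⟩
    concat Z ++ (u ++ []) ++ c                              ≡⟨ cong (λ w → concat Z ++ w ++ c) (++-identityʳ u) ⟩
    concat Z ++ u ++ c                                      ≡⟨ cong (concat Z ++_) (++-identityʳ (u ++ c)) ⟨
    concat Z ++ concat [ u ++ c ]                           ≡⟨ concat-++ Z [ u ++ c ] ⟩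
    concat (Z ∷ʳ (u ++ c))                                  ≡⟨ cong concat (update-∷ʳ (join false c) Z u) ⟨
    concat (update (length Z) (join false c) (Z ∷ʳ u))      ≡⟨ cong (λ j → concat (update j (join false c) (Z ∷ʳ u))) k≡ ⟨
    concat (update k (join false c) (Z ∷ʳ u))               ∎

layout-cong : ∀ {cs ds} f x → (∀ {j} → j ∈ labels x → nth [] ds (f j) ≡ nth [] cs j) → layout ds (relabel f x) ≡ layout cs x
layout-cong f []            h = refl
layout-cong f ((j , σ) ∷ x) h = cong₂ (λ c X → orient σ c ++ X) (h (here refl)) (layout-cong f x (h ∘ there))

layout-rotate : ∀ {k} cs x → length cs ≡ suc k → Valid (suc k) x → layout (rotate cs) (shift k x) ≡ layout cs x
layout-rotate cs x len v = layout-cong _ x (λ i → nth-rotate [] cs len (≤-pred (valid-< {x = x} v i)))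

layout-iterate : ∀ {k} i cs x → length cs ≡ suc k → Valid (suc k) x →
                 layout (iterate rotate cs i) (iterate (shift k) x i) ≡ layout cs x
layout-iterate zero    cs x len v = refl
layout-iterate (suc i) cs x len v = trans
  (layout-iterate i (rotate cs) (shift _ x) (trans (length-rotate cs) len) (shift-valid {x = x} v)) (layout-rotate cs x len v)

-- A cyclically sorted stack A B is sorted by the flips of A, of everything and of B.
unrotate : ∀ {n} l → IsRotation n l → Reach 3 l (sorted n)
unrotate {n} l (rotation i eq) with cut i l
  where
  cut : ∀ i (l : List ℕ) → ∃₂ λ A B → l ≡ A ++ B × iterate rotate l i ≡ B ++ A
  cut zero    l = [] , l , refl , sym (++-identityʳ l)
  cut (suc i) l with cut i l
  ... | A , b ∷ B , l≡ , r≡ = A ∷ʳ b , B , trans l≡ (sym (++-assoc A [ b ] B)) ,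
    trans (iterate-comm rotate i l) (trans (cong rotate r≡) (++-assoc B A [ b ]))
  ... | a ∷ A , [] , l≡ , r≡ = [ a ] , A , trans l≡ (++-identityʳ (a ∷ A)) , trans (iterate-comm rotate i l) (cong rotate r≡)
  ... | [] , [] , l≡ , r≡ = [] , [] , l≡ , trans (iterate-comm rotate i l) (cong rotate r≡)
... | [] , B , refl , r≡ = weaken z≤n (between (trans (sym (++-identityʳ B)) (trans (sym r≡) eq)) stay refl)
... | a ∷ A , [] , refl , r≡ = weaken z≤n (between (trans (++-identityʳ (a ∷ A)) (trans (sym r≡) eq)) stay refl)
... | a ∷ A , b ∷ B , refl , r≡ =
  flipPrefix A′ B′ (s≤s z≤n) then
  between (sym (++-identityʳ _)) (flipPrefix (reverse A′ ++ B′) [] (nonEmpty-++ʳ (reverse A′) B′ (s≤s z≤n))) middle then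
  between refl (flipPrefix (reverse B′) A′ (nonEmpty-reverse B′ (s≤s z≤n))) (trans (cong (_++ A′) (reverse-involutive B′)) (trans (sym r≡) eq))
  where
  A′ = a ∷ A
  B′ = b ∷ B
  middle : reverse (reverse A′ ++ B′) ++ [] ≡ reverse B′ ++ A′
  middle = trans (++-identityʳ _) (trans (reverse-++ (reverse A′) B′) (cong (reverse B′ ++_) (reverse-involutive A′)))

orient-up : ∀ σ c Y → NonEmpty c → Reach 1 (orient σ c ++ Y) (c ++ Y)
orient-up true  c Y ne = weaken z≤n stay
orient-up false c Y ne = between refl (flipPrefix (reverse c) Y (nonEmpty-reverse c ne)) (cong (_++ Y) (reverse-involutive c))

-- With `d` upside down, flip everything, then `d`, then everything: `d ++ reverse c`, then
-- `reverse d ++ reverse c`, then `c ++ d`.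
orient-below : ∀ τ c d → NonEmpty c → NonEmpty d → Reach 3 (c ++ orient τ d) (c ++ d)
orient-below true  c d ne nd = weaken z≤n stay
orient-below false c d ne nd =
  between (sym (++-identityʳ _)) (flipPrefix (c ++ reverse d) [] (nonEmpty-++ c _ ne)) first then
  flipPrefix d (reverse c) nd then
  between (sym (++-identityʳ _)) (flipPrefix (reverse d ++ reverse c) [] (nonEmpty-++ʳ (reverse d) _ (nonEmpty-reverse c ne))) third
  where
  first : reverse (c ++ reverse d) ++ [] ≡ d ++ reverse c
  first = trans (++-identityʳ _) (trans (reverse-++ c (reverse d)) (cong (_++ reverse c) (reverse-involutive d)))
  third : reverse (reverse d ++ reverse c) ++ [] ≡ c ++ d
  third = trans (++-identityʳ _) (trans (cong reverse (sym (reverse-++ c d))) (reverse-involutive (c ++ d)))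

solve-one : ∀ {n W c} σ y → Fits W c → Valid 0 y → IsRotation n (concat [ c ]) → Reach 7 (orient σ c ++ layout [ c ] (relabel suc y)) (sorted n)
solve-one σ []      f v h = weaken (s≤s (s≤s (s≤s (s≤s z≤n)))) (orient-up σ _ _ (fits-nonEmpty f) then unrotate _ h)
solve-one σ (_ ∷ _) f v h = contradiction v Perm.¬x∷xs↭[]

solve-two : ∀ {n t u c d} σ y → Fits t c → Fits u d → Valid 1 y → IsRotation n (concat (c ∷ d ∷ [])) →
            Reach 7 (orient σ c ++ layout (c ∷ d ∷ []) (relabel suc y)) (sorted n)
solve-two σ []            f g v h = contradiction (↭-sym v) Perm.¬x∷xs↭[]
solve-two {c = c} {d} σ ((j , τ) ∷ []) f g v h with refl ← Perm.↭-singleton-inv v =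
  orient-up σ c _ (fits-nonEmpty f) then
  between (cong (c ++_) (++-identityʳ (orient τ d))) (orient-below τ c d (fits-nonEmpty f) (fits-nonEmpty g))
    (cong (c ++_) (sym (++-identityʳ d))) then
  unrotate _ h
solve-two σ (_ ∷ _ ∷ _)   f g v h = contradiction (Perm.↭-length v) λ ()

-- The invariants after rotating the top label to `0`, bundled so that the rotated word and contents
-- can be generalised before they are matched on.
record Rooted (n m : ℕ) (W : Word) (cs : List (List ℕ)) (v : ℕ) (σ : Bool) (z : Stack) : Set where
  field
    length-word : length (iterate rotate W v) ≡ suc m
    fits        : Pointwise Fits (iterate rotate W v) (iterate rotate cs v)
    is-rotation : IsRotation n (concat (iterate rotate cs v))
    valid       : Valid m (relabel pred (iterate (shift m) z v))
    same        : layout cs ((v , σ) ∷ z) ≡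
                  layout (iterate rotate cs v) ((0 , σ) ∷ relabel suc (relabel pred (iterate (shift m) z v)))

toRooted : ∀ {n m W cs v σ z} → length W ≡ suc m → Pointwise Fits W cs → Valid (suc m) ((v , σ) ∷ z) →
           IsRotation n (concat cs) → Rooted n m W cs v σ z
toRooted {n} {m} {W} {cs} {v} {σ} {z} len fs val h = record
  { length-word = trans (length-iterate-rotate v W) len
  ; fits        = iterate-fits v fs
  ; is-rotation = iterate-preserves (IsRotation n ∘ concat) (λ {cs} → isRotation-rotate cs) v h
  ; valid       = proj₁ below
  ; same        = trans (sym (layout-iterate v cs ((v , σ) ∷ z) (trans (sym (Pointwise.Pointwise-length fs)) len) val))
                        (cong (layout (iterate rotate cs v)) (trans (proj₁ top) (cong ((0 , σ) ∷_) (sym (proj₂ below)))))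
  }
  where
  top = rotated {m} {v} {σ} {z} val
  below = relabel-pred {m} {σ} {iterate (shift m) z v} (proj₂ top)
  iterate-fits : ∀ i {V cs} → Pointwise Fits V cs → Pointwise Fits (iterate rotate V i) (iterate rotate cs i)
  iterate-fits zero    fs = fs
  iterate-fits (suc i) fs = iterate-fits i (fits-rotate fs)

Solves : ℕ → ℕ → Set
Solves n m = ∀ W cs x → length W ≡ m → Pointwise Fits W cs → Valid m x → IsRotation n (concat cs) →
             Reach (cost m W x) (layout cs x) (sorted n)

solve-step : ∀ {n k V ds} σ y → Solves n (suc (suc k)) → Valid (suc (suc k)) y → length V ≡ suc (suc (suc k)) →
  Pointwise Fits V ds → IsRotation n (concat ds) →
  let K = suc (suc k) in
  Reach (price K (ruleOf K V) σ y + cost K (after K (ruleOf K V) (rest V)) (move K (ruleOf K V) σ y))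
        (layout ds ((0 , σ) ∷ relabel suc y)) (sorted n)
solve-step {k = k} {t ∷ V} {c ∷ ds} σ y solves v len (f ∷ fs) h with rule-step (s≤s (s≤s z≤n)) (cong pred len) fs t c σ y f v
... | step s fs′ reached =
  between (cong (orient σ c ++_) (layout-cong suc y (λ _ → refl))) reached refl then
  solves _ _ _ (trans (length-after (rule K t V)) (cong pred len)) fs′
    (move-valid K (s≤s (s≤s z≤n)) (rule K t V) σ {y} v)
    (isRotation-join s c ds (trans (sym (Pointwise.Pointwise-length fs)) (cong pred len)) h)
  where
  K = suc (suc k)
  length-after : ∀ r → length (after K r V) ≡ length V
  length-after (pair s)   = length-update (side K s) _ V
  length-after (single s) = length-update (side K s) _ V
  length-after (extend s) = length-update (side K s) _ V
  length-after blocks     = refl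

solve : ∀ n m → Solves n (suc m)
solve n m W cs [] len fs val h = contradiction (↭-sym val) Perm.¬x∷xs↭[]
solve n zero W cs ((v , σ) ∷ z) len fs val h = between (Rooted.same r)
  (go (Rooted.length-word r) (Rooted.fits r) (Rooted.is-rotation r)) refl
  where
  r = toRooted {σ = σ} {z} len fs val h
  go : ∀ {V ds} → length V ≡ 1 → Pointwise Fits V ds → IsRotation n (concat ds) →
       Reach 7 (layout ds ((0 , σ) ∷ relabel suc (relabel pred (iterate (shift 0) z v)))) (sorted n)
  go len (f ∷ []) h = solve-one σ _ f (Rooted.valid r) h
solve n (suc zero) W cs ((v , σ) ∷ z) len fs val h = between (Rooted.same r)
  (go (Rooted.length-word r) (Rooted.fits r) (Rooted.is-rotation r)) refl
  where
  r = toRooted {σ = σ} {z} len fs val h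
  go : ∀ {V ds} → length V ≡ 2 → Pointwise Fits V ds → IsRotation n (concat ds) →
       Reach 7 (layout ds ((0 , σ) ∷ relabel suc (relabel pred (iterate (shift 1) z v)))) (sorted n)
  go len (f ∷ g ∷ []) h = solve-two σ _ f g (Rooted.valid r) h
solve n (suc (suc k)) W cs ((v , σ) ∷ z) len fs val h = between (Rooted.same r)
  (solve-step σ _ (solve n (suc k)) (Rooted.valid r) (Rooted.length-word r) (Rooted.fits r) (Rooted.is-rotation r)) refl
  where
  r = toRooted {σ = σ} {z} len fs val h

-- The average over all stacks

-- For odd `n` the last pancake has no partner and is declared a block. It is worth 39 instead of
-- 34, which is the 5 in `potential-pairedWord`.
pairedWord : ℕ → Word
pairedWord zero          = []
pairedWord (suc zero)    = [ blk ]
pairedWord (suc (suc n)) = one true ∷ one false ∷ pairedWord n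

length-pairedWord : ∀ n → length (pairedWord n) ≡ n
length-pairedWord zero          = refl
length-pairedWord (suc zero)    = refl
length-pairedWord (suc (suc n)) = cong (suc ∘ suc) (length-pairedWord n)

pairedWord-fits : ∀ n xs → length xs ≡ n → Pointwise Fits (pairedWord n) (map [_] xs)
pairedWord-fits zero          []           eq = []
pairedWord-fits (suc zero)    (x ∷ [])     eq = blk ∷ []
pairedWord-fits (suc (suc n)) (x ∷ y ∷ xs) eq = one ∷ one ∷ pairedWord-fits n xs (cong (pred ∘ pred) eq)

-- The potential of `one true ∷ one false ∷ pairedWord n` without the 32 of its first letter, whose
-- link to the partner is 0. Fixing these two letters keeps the cyclic closure constant, so each
-- further pair adds 32 + 4 + 32 + 0 = 68.
tail-potential : ℕ → ℕ
tail-potential n = walk (one false) (pairedWord n) + (weight (end (one false) (pairedWord n)) + link (end (one false) (pairedWord n)) (one true))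

tail-potential-bound : ∀ n → tail-potential n ≤ 34 * n + 41
tail-potential-bound zero          = ≤ᵇ⇒≤ 36 41 _
tail-potential-bound (suc zero)    = ≤-refl
tail-potential-bound (suc (suc n)) = begin
  tail-potential (suc (suc n))   ≤⟨ +-monoʳ-≤ 68 (tail-potential-bound n) ⟩
  68 + (34 * n + 41)             ≡⟨ rearrange n ⟩
  34 * suc (suc n) + 41          ∎
  where
  open ≤-Reasoning
  rearrange : ∀ n → 68 + (34 * n + 41) ≡ 34 * (1 + (1 + n)) + 41
  rearrange = solve-∀

potential-pairedWord : ∀ n → potential (pairedWord n) ≤ 34 * n + 5
potential-pairedWord zero          = z≤n
potential-pairedWord (suc zero)    = ≤-refl
potential-pairedWord (suc (suc n)) = ≤-trans (+-monoʳ-≤ 32 (tail-potential-bound n)) (≤-reflexive (rearrange n))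
  where
  rearrange : ∀ n → 32 + (34 * n + 41) ≡ 34 * (1 + (1 + n)) + 5
  rearrange = solve-∀

-- Random signs and the encoding of stacks.

signs : ℕ → List (List Bool)
signs zero    = [ [] ]
signs (suc n) = map (true ∷_) (signs n) ++ map (false ∷_) (signs n)

length-signs : ∀ n → length (signs n) ≡ 2 ^ n
length-signs zero    = refl
length-signs (suc n) = begin
  length (map (true ∷_) (signs n) ++ map (false ∷_) (signs n))          ≡⟨ length-++ (map (true ∷_) (signs n)) ⟩
  length (map (true ∷_) (signs n)) + length (map (false ∷_) (signs n))  ≡⟨ cong₂ _+_ (length-map _ (signs n)) (length-map _ (signs n)) ⟩
  length (signs n) + length (signs n)                                   ≡⟨ 2* (length (signs n)) ⟩
  2 * length (signs n)                                                  ≡⟨ cong (2 *_) (length-signs n) ⟩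
  2 * 2 ^ n                                                             ∎
  where open ≡-Reasoning

signs-unique : ∀ n → Unique (signs n)
signs-unique zero    = [] ∷ []
signs-unique (suc n) = Unique.++⁺ (Unique.map⁺ ∷-injectiveʳ (signs-unique n)) (Unique.map⁺ ∷-injectiveʳ (signs-unique n)) different
  where
  different : Disjoint (map (true ∷_) (signs n)) (map (false ∷_) (signs n))
  different (i , j) with _ , _ , refl ← ∈-map⁻ _ i | _ , _ , () ← ∈-map⁻ _ j

∈-signs⁺ : ∀ n s → length s ≡ n → s ∈ signs n
∈-signs⁺ zero    []          eq = here refl
∈-signs⁺ (suc n) (true ∷ s)  eq = ∈-++⁺ˡ (∈-map⁺ _ (∈-signs⁺ n s (cong pred eq)))
∈-signs⁺ (suc n) (false ∷ s) eq = ∈-++⁺ʳ (map (true ∷_) (signs n)) (∈-map⁺ _ (∈-signs⁺ n s (cong pred eq)))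

∈-signs⁻ : ∀ n {s} → s ∈ signs n → length s ≡ n
∈-signs⁻ zero    (here refl) = refl
∈-signs⁻ (suc n) i with ∈-++⁻ (map (true ∷_) (signs n)) i
... | inj₁ j with s , h , refl ← ∈-map⁻ _ j = cong suc (∈-signs⁻ n h)
... | inj₂ j with s , h , refl ← ∈-map⁻ _ j = cong suc (∈-signs⁻ n h)

encode : List ℕ → List Bool → Stack
encode = zipWith (λ p σ → pred p , σ)

decode : Stack → List ℕ
decode = map (suc ∘ proj₁)

labels-encode : ∀ π s → length s ≡ length π → labels (encode π s) ≡ map pred π
labels-encode []      []      eq = refl
labels-encode (p ∷ π) (b ∷ s) eq = cong (pred p ∷_) (labels-encode π s (cong pred eq))

signs-encode : ∀ π s → length s ≡ length π → map proj₂ (encode π s) ≡ s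
signs-encode []      []      eq = refl
signs-encode (p ∷ π) (b ∷ s) eq = cong (b ∷_) (signs-encode π s (cong pred eq))

encode-decode : ∀ x → encode (decode x) (map proj₂ x) ≡ x
encode-decode []      = refl
encode-decode (p ∷ x) = cong (p ∷_) (encode-decode x)

decode-encode : ∀ π s → length s ≡ length π → (∀ {p} → p ∈ π → suc (pred p) ≡ p) → decode (encode π s) ≡ π
decode-encode []      []      eq h = refl
decode-encode (p ∷ π) (b ∷ s) eq h = cong₂ _∷_ (h (here refl)) (decode-encode π s (cong pred eq) (h ∘ there))

length-sorted : ∀ n → length (sorted n) ≡ n
length-sorted n = trans (length-map suc (upTo n)) (length-upTo n)

module _ {n : ℕ} {π : List ℕ} (perm : π ↭ sorted n) where

  perm-length : length π ≡ n
  perm-length = trans (Perm.↭-length perm) (length-sorted n)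

  perm-suc : ∀ {p} → p ∈ π → suc (pred p) ≡ p
  perm-suc i with _ , _ , refl ← ∈-map⁻ suc (Perm.∈-resp-↭ perm i) = refl

  encode-valid : ∀ s → length s ≡ n → Valid n (encode π s)
  encode-valid s eq = ↭-trans (↭-reflexive (labels-encode π s (trans eq (sym perm-length))))
    (↭-trans (Perm.map⁺ pred perm) (↭-reflexive (trans (sym (map-∘ (upTo n))) (map-id (upTo n)))))

nth-sorted : ∀ n j → j < n → nth [] (map [_] (sorted n)) j ≡ [ suc j ]
nth-sorted n j j<n = trans (cong (λ xs → nth [] (map [_] xs) j) (map-upTo suc n)) (go n j suc j<n)
  where
  go : ∀ n j (f : ℕ → ℕ) → j < n → nth [] (map [_] (applyUpTo f n)) j ≡ [ f j ]
  go (suc n) zero    f lt       = refl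
  go (suc n) (suc j) f (s≤s lt) = go n j (f ∘ suc) lt

layout-singletons : ∀ n x → (∀ {j} → j ∈ labels x → j < n) → layout (map [_] (sorted n)) x ≡ decode x
layout-singletons n []            h = refl
layout-singletons n ((j , σ) ∷ x) h =
  cong₂ _++_ (trans (cong (orient σ) (nth-sorted n j (h (here refl)))) (singleton σ)) (layout-singletons n x (h ∘ there))
  where
  singleton : ∀ σ → orient σ [ suc j ] ≡ [ suc j ]
  singleton true  = refl
  singleton false = refl

solution : ∀ n x → Valid (suc n) x → Reach (cost (suc n) (pairedWord (suc n)) x) (decode x) (sorted (suc n))
solution n x v = between (sym (layout-singletons (suc n) x (valid-< {x = x} v)))
  (solve (suc n) n (pairedWord (suc n)) (map [_] (sorted (suc n))) x (length-pairedWord (suc n))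
    (pairedWord-fits (suc n) (sorted (suc n)) (length-sorted (suc n))) v
    (rotation 0 (concat-map-[_] (sorted (suc n))))) refl

-- Deciding membership in `stacks` yields the validity proof that `solution` asks for, so the flips
-- are a function of the signed stack alone.
algorithm : ∀ n → Stack → List ℕ
algorithm n x with x ∈? stacks (suc n)
... | yes i = Reach.flips (solution n x (stacks⁻ (suc n) i))
... | no _  = []

algorithm-short : ∀ n x → length (algorithm n x) ≤ cost (suc n) (pairedWord (suc n)) x
algorithm-short n x with x ∈? stacks (suc n)
... | yes i = Reach.short (solution n x (stacks⁻ (suc n) i))
... | no _  = z≤n

algorithm-correct : ∀ n x → Valid (suc n) x →
  All (ValidFlip (length (decode x))) (algorithm n x) × applyFlips (algorithm n x) (decode x) ≡ sorted (suc n)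
algorithm-correct n x v with x ∈? stacks (suc n)
... | yes i = Reach.valid r , Reach.correct r
  where r = solution n x (stacks⁻ (suc n) i)
... | no ¬i = contradiction (stacks⁺ (suc n) v) ¬i

count-formula : ∀ n → count n ≡ n ! * 2 ^ n
count-formula zero    = count-zero
count-formula (suc n) = begin
  count (suc n)                ≡⟨ count-suc n ⟩
  suc n * (2 * count n)        ≡⟨ cong (λ c → suc n * (2 * c)) (count-formula n) ⟩
  suc n * (2 * (n ! * 2 ^ n))  ≡⟨ rearrange (suc n) (n !) (2 ^ n) ⟩
  suc n * n ! * (2 * 2 ^ n)    ∎
  where
  open ≡-Reasoning
  rearrange : ∀ a b c → a * (2 * (b * c)) ≡ a * b * (2 * c)
  rearrange = solve-∀

expected-cost : ∀ n → 12 * ∑ (stacks n) (cost n (pairedWord n)) ≤ (17 * n + 108) * n ! * 2 ^ n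
expected-cost n = *-cancelˡ-≤ 2 (begin
  2 * (12 * ∑ (stacks n) (cost n (pairedWord n)))  ≡⟨ *-assoc 2 12 (∑ (stacks n) (cost n (pairedWord n))) ⟨
  24 * ∑ (stacks n) (cost n (pairedWord n))        ≤⟨ cost-bound n (pairedWord n) (length-pairedWord n) ⟩
  count n * (potential (pairedWord n) + 168)       ≤⟨ *-monoʳ-≤ (count n) (+-monoˡ-≤ 168 (potential-pairedWord n)) ⟩
  -- 173 is 5 for an odd pancake and 7 flips of 24 for the end; 216 is 9 flips of 24.
  count n * (34 * n + 5 + 168)                     ≤⟨ *-monoʳ-≤ (count n) (≤-trans (≤-reflexive (+-assoc (34 * n) 5 168)) (+-monoʳ-≤ (34 * n) (≤ᵇ⇒≤ 173 216 _))) ⟩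
  count n * (34 * n + 216)                         ≡⟨ cong (_* (34 * n + 216)) (count-formula n) ⟩
  n ! * 2 ^ n * (34 * n + 216)                     ≡⟨ rearrange (n !) (2 ^ n) n ⟩
  2 * ((17 * n + 108) * n ! * 2 ^ n)               ∎)
  where
  open ≤-Reasoning
  rearrange : ∀ a b n → a * b * (34 * n + 216) ≡ 2 * ((17 * n + 108) * a * b)
  rearrange = solve-∀

module _ (n : ℕ) (L : List (List ℕ)) (unique : Unique L) (complete : ∀ π → (π ∈ L) ⇔ (π ↭ sorted n)) where

  private
    encodings : List Stack
    encodings = concatMap (λ π → map (encode π) (signs n)) L

    perm : ∀ {π} → π ∈ L → π ↭ sorted n
    perm {π} = Equivalence.to (complete π)

    ∈-encodings : ∀ {x} → x ∈ encodings → ∃₂ λ π s → π ∈ L × s ∈ signs n × x ≡ encode π s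
    ∈-encodings i with _ , x∈ , xs∈ ← ∈-concat⁻′ (map (λ π → map (encode π) (signs n)) L) i
      with π , π∈ , refl ← ∈-map⁻ _ xs∈ with s , s∈ , refl ← ∈-map⁻ (encode π) x∈ = π , s , π∈ , s∈ , refl

    same-length : ∀ {π s} → π ∈ L → s ∈ signs n → length s ≡ length π
    same-length π∈ s∈ = trans (∈-signs⁻ n s∈) (sym (perm-length (perm π∈)))

    recover : ∀ {π s} → π ∈ L → s ∈ signs n → decode (encode π s) ≡ π
    recover {π} {s} π∈ s∈ = decode-encode π s (same-length π∈ s∈) (perm-suc (perm π∈))

    encodings-unique : Unique encodings
    encodings-unique = Unique.concat⁺
      (All.map⁺ (All.tabulate λ {π} π∈ → AllPairs.map⁺ (AllPairs-map-∈ (signs n)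
        (λ {s} {t} s∈ t∈ s≢t eq → s≢t (trans (sym (signs-encode π s (same-length π∈ s∈))) (trans (cong (map proj₂) eq) (signs-encode π t (same-length π∈ t∈)))))
        (signs-unique n))))
      (AllPairs.map⁺ (AllPairs-map-∈ L disjoint unique))
      where
      disjoint : ∀ {π ρ} → π ∈ L → ρ ∈ L → π ≢ ρ → Disjoint (map (encode π) (signs n)) (map (encode ρ) (signs n))
      disjoint {π} {ρ} π∈ ρ∈ π≢ρ (i , j) with s , s∈ , refl ← ∈-map⁻ (encode π) i with t , t∈ , eq ← ∈-map⁻ (encode ρ) j =
        π≢ρ (trans (sym (recover π∈ s∈)) (trans (cong decode eq) (recover ρ∈ t∈)))

    encodings-↭ : encodings ↭ stacks n
    encodings-↭ = unique-⇔-↭ encodings-unique (stacks-unique n) (mk⇔ to from)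
      where
      to : ∀ {x} → x ∈ encodings → x ∈ stacks n
      to i with π , s , π∈ , s∈ , refl ← ∈-encodings i = stacks⁺ n (encode-valid (perm π∈) s (∈-signs⁻ n s∈))
      from : ∀ {x} → x ∈ stacks n → x ∈ encodings
      from {x} i = ∈-concat⁺′ (subst (_∈ map (encode (decode x)) (signs n)) (encode-decode x) (∈-map⁺ (encode (decode x)) s∈)) (∈-map⁺ _ π∈)
        where
        v : Valid n x
        v = stacks⁻ n i
        π∈ : decode x ∈ L
        π∈ = Equivalence.from (complete (decode x)) (↭-trans (↭-reflexive (map-∘ x)) (Perm.map⁺ suc v))
        s∈ : map proj₂ x ∈ signs n
        s∈ = ∈-signs⁺ n (map proj₂ x) (trans (length-map proj₂ x) (trans (sym (length-map proj₁ x)) (trans (Perm.↭-length v) (length-upTo n))))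

  -- A permutation together with a string of signs is the same as a signed arrangement, so the
  -- average over stacks and random bits is the uniform average over `stacks n`.
  ∑-encodings : (f : Stack → ℕ) → ∑ L (λ π → ∑ (signs n) (λ s → f (encode π s))) ≡ ∑ (stacks n) f
  ∑-encodings f = begin
    ∑ L (λ π → ∑ (signs n) (λ s → f (encode π s)))     ≡⟨ ∑-cong L (λ π → ∑-map (encode π) (signs n) f) ⟨
    ∑ L (λ π → ∑ (map (encode π) (signs n)) f)         ≡⟨ ∑-concatMap (λ π → map (encode π) (signs n)) L f ⟨
    ∑ encodings f                                      ≡⟨ ∑-↭ f encodings-↭ ⟩
    ∑ (stacks n) f                                     ∎
    where open ≡-Reasoning

∑-lookup : {A : Set} (xs : List A) (f : A → ℕ) → ∑ (allFin (length xs)) (f ∘ lookup xs) ≡ ∑ xs f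
∑-lookup xs f = cong sum (trans (map-tabulate id (f ∘ lookup xs)) (trans (sym (map-tabulate (lookup xs) f)) (cong (map f) (tabulate-lookup xs))))

theorem4 : (n : ℕ) → 1 ≤ n →
    Σ ℕ λ k → Σ (Fin k → List ℕ → List ℕ) λ A →
    (0 < k) ×
    ((r : Fin k) (π : List ℕ) → π ↭ sorted n →
    All (ValidFlip n) (A r π) × (applyFlips (A r π) π ≡ sorted n)) ×
    ((L : List (List ℕ)) → Unique L → ((π : List ℕ) → (π ∈ L) ⇔ (π ↭ sorted n)) →
    12 * sum (map (λ π → sum (map (λ r → length (A r π)) (allFin k))) L)
    ≤ (17 * n + 108) * (n !) * k)
theorem4 (suc m) _ = length (signs n) , A , positive , correct , average
  where
  n = suc m
  A : Fin (length (signs n)) → List ℕ → List ℕ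
  -- The random bits only choose the initial signs; all later choices are determined by them and
  -- `π`.
  A r π = algorithm m (encode π (lookup (signs n) r))
  positive : 0 < length (signs n)
  positive = subst (0 <_) (sym (length-signs n)) (m^n>0 2 n)
  correct : ∀ r π → π ↭ sorted n → All (ValidFlip n) (A r π) × applyFlips (A r π) π ≡ sorted n
  correct r π perm = subst (λ k → All (ValidFlip k) (A r π)) (perm-length perm) (proj₁ both) , proj₂ both
    where
    s = lookup (signs n) r
    s-length : length s ≡ n
    s-length = ∈-signs⁻ n (∈-lookup r)
    recovered : decode (encode π s) ≡ π
    recovered = decode-encode π s (trans s-length (sym (perm-length perm))) (perm-suc perm)
    both : All (ValidFlip (length π)) (A r π) × applyFlips (A r π) π ≡ sorted n
    both = subst (λ ρ → All (ValidFlip (length ρ)) (A r π) × applyFlips (A r π) ρ ≡ sorted n) recovered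
      (algorithm-correct m (encode π s) (encode-valid perm s s-length))
  average : (L : List (List ℕ)) → Unique L → ((π : List ℕ) → (π ∈ L) ⇔ (π ↭ sorted n)) →
            12 * ∑ L (λ π → ∑ (allFin (length (signs n))) (λ r → length (A r π))) ≤ (17 * n + 108) * (n !) * length (signs n)
  average L unique complete = begin
    12 * ∑ L (λ π → ∑ (allFin (length (signs n))) (λ r → length (A r π)))
      ≡⟨ cong (12 *_) (∑-cong L (λ π → ∑-lookup (signs n) (λ s → length (algorithm m (encode π s))))) ⟩
    12 * ∑ L (λ π → ∑ (signs n) (λ s → length (algorithm m (encode π s))))
      ≡⟨ cong (12 *_) (∑-encodings n L unique complete (λ x → length (algorithm m x))) ⟩
    12 * ∑ (stacks n) (λ x → length (algorithm m x))
      ≤⟨ *-monoʳ-≤ 12 (∑-mono-∈ (stacks n) (λ {x} _ → algorithm-short m x)) ⟩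
    12 * ∑ (stacks n) (cost n (pairedWord n))
      ≤⟨ expected-cost n ⟩
    (17 * n + 108) * n ! * 2 ^ n
      ≡⟨ cong ((17 * n + 108) * n ! *_) (length-signs n) ⟨
    (17 * n + 108) * n ! * length (signs n) ∎
    where open ≤-Reasoning
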